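{- Let $\mathbf{Ctx}\hookrightarrow\mathbb{F}$ be a contextual subcategory. The substitution tensor $\diamond$ yields a right-closed monoidal category $([\mathbf{Ctx},\mathbf{Set}],\diamond,V)$ with unit $V=\mathbf{Ctx}(1,-)$ and internal homs $[Y,Z]_\diamond=\mathrm{Nat}((-)\triangleleft Y,Z)$, i.e. $[Y,Z]_\diamond(A)=\mathrm{Nat}(A\triangleleft Y,Z)$, so that $\mathrm{Nat}(X\diamond Y,Z)\cong\mathrm{Nat}(X,[Y,Z]_\diamond)$ naturally.
   Context: $\mathbb{F}$ is the category of finite sets and functions (replaced by an equivalent small category). $[\mathbf{Ctx},\mathbf{Set}]$ is the category of covariant presheaves and natural transformations; for a presheaf $X$, $f\colon A\to B$ and $x\in XA$ write $f\cdot x:=X(f)(x)$. A subcategory $\mathbf{Ctx}\hookrightarrow\mathbb{F}$ is contextual if (1) it contains all objects of $\mathbb{F}$; (2) it is closed under the monoidal structure $+$ (disjoint union): $f,g\in\mathbf{Ctx}$ implies $f+g\in\mathbf{Ctx}$; (3) it is pullback-stable: for every pullback square in $\mathbb{F}$ of maps $f\colon X\to Y$ and $b\colon B\to Y$, with projections $f^*b\colon f^*B\to X$ and $r_f\colon f^*B\to B$, if $f\in\mathbf{Ctx}$ then $r_f\in\mathbf{Ctx}$. For a map $b\colon B\to A$ write $B_a=b^{ -1}(a)$. Let $\mathbf{y}B=\mathbf{Ctx}(B,-)$. For $A\in\mathbf{Ctx}$ and $X\in[\mathbf{Ctx},\mathbf{Set}]$, the substitution presheaf is $A\triangleleft X=\int^{(B\to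 A)}\mathbf{y}B\times\prod_{a\in A}XB_a$, the coend ranging over finite sets $B\to A$ over $A$ and maps over $A$ lying in $\mathbf{Ctx}$. Concretely, $(A\triangleleft X)C$ consists of equivalence classes $[g,(t_a)_{a\in A}]$ with $g\in\mathbf{Ctx}(B,C)$, $B\to A$ in $\mathbb{F}$ and $t_a\in XB_a$, modulo $[g'\cdot j,(t_a)]=[g',(j_a\cdot t_a)]$ for maps $j\colon B\to B'$ over $A$ in $\mathbf{Ctx}$ (with restrictions $j_a\colon B_a\to B'_a$) and $g'\in\mathbf{Ctx}(B',C)$. It is contravariantly functorial in $A$: for $f\colon A'\to A$ in $\mathbf{Ctx}$, $[g,(t_a)_{a\in A}]\cdot f=[g\cdot r_f,(t_{f(a')})_{a'\in A'}]$ where $r_f\colon f^*B\to B$. The substitution tensor is $X\diamond Y=\int^{A\in\mathbf{Ctx}}XA\times(A\triangleleft Y)$: elements of $(X\diamond Y)C$ are classes $[x,\gamma]$ with $x\in XA$, $\gamma\in(A\triangleleft Y)C$, modulo the equivalence relation generated by $(j\cdot x,\gamma)\sim(x,\gamma\cdot j)$ for $j\in\mathbf{Ctx}(A,A')$, $x\in XA$, $\gamma\in(A'\triangleleft Y)C$. -}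

module Defs where

open import Data.Fin.Base using (Fin; zero; suc; join; splitAt)
open import Data.Fin.Properties using (_≟_)
open import Data.List.Base using (List; []; _∷_; length; lookup; filter; allFin; cartesianProduct)
open import Data.List.Membership.Propositional using (_∈_)
open import Data.List.Membership.Propositional.Properties using (∈-filter⁺; ∈-filter⁻; ∈-lookup; ∈-allFin; ∈-cartesianProduct⁺)
open import Data.List.Relation.Unary.All as All using (All)
open import Data.List.Relation.Unary.AllPairs using (AllPairs; []; _∷_)
open import Data.List.Relation.Unary.Any using (index)
open import Data.List.Relation.Unary.Any.Properties using (lookup-index)
open import Data.List.Relation.Unary.Unique.Propositional using (Unique)
open import Data.List.Relation.Unary.Unique.Propositional.Properties using (allFin⁺; filter⁺; cartesianProduct⁺)
open import Data.Nat.Base using (ℕ; _+_)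
open import Data.Product.Base using (Σ-syntax; _×_; _,_; proj₁; proj₂)
open import Data.Sum.Base as Sum using (_⊎_)
open import Function.Base using (_∘_; id)
open import Function.Bundles using (Inverse)
open import Level using (Level; 0ℓ; _⊔_) renaming (suc to lsuc)
open import Relation.Binary.Bundles using (Setoid)
open import Relation.Binary.Structures using (IsEquivalence)
open import Relation.Binary.Construct.Closure.Equivalence as EqC using (EqClosure)
open import Relation.Binary.PropositionalEquality using (_≡_; _≗_; refl; sym; trans; cong; cong₂)
open import Relation.Nullary.Negation.Core using (contradiction)
open import Relation.Unary using (Pred; Decidable)

------------------------------------------------------------------------
-- Categories (hom-setoids), monoidal and right-closed structure

record Category (o ℓ e : Level) : Set (lsuc (o ⊔ ℓ ⊔ e)) where
  infix  4 _⇒_ _≈_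
  infixr 9 _⊙_
  field
    Obj       : Set o
    _⇒_       : Obj → Obj → Set ℓ
    _≈_       : ∀ {A B} → A ⇒ B → A ⇒ B → Set e
    idm       : ∀ {A} → A ⇒ A
    _⊙_       : ∀ {A B C} → B ⇒ C → A ⇒ B → A ⇒ C
    equiv     : ∀ {A B} → IsEquivalence (_≈_ {A} {B})
    identityˡ : ∀ {A B} {f : A ⇒ B} → idm ⊙ f ≈ f
    identityʳ : ∀ {A B} {f : A ⇒ B} → f ⊙ idm ≈ f
    assoc     : ∀ {A B C D} {f : A ⇒ B} {g : B ⇒ C} {h : C ⇒ D} →
                (h ⊙ g) ⊙ f ≈ h ⊙ (g ⊙ f)
    ⊙-resp-≈  : ∀ {A B C} {f f′ : B ⇒ C} {g g′ : A ⇒ B} →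
                f ≈ f′ → g ≈ g′ → f ⊙ g ≈ f′ ⊙ g′

  hom-setoid : Obj → Obj → Setoid ℓ e
  hom-setoid A B = record
    { Carrier = A ⇒ B ; _≈_ = _≈_ ; isEquivalence = equiv }

  record IsInverse {A B} (f : A ⇒ B) (g : B ⇒ A) : Set e where
    field
      invˡ : f ⊙ g ≈ idm
      invʳ : g ⊙ f ≈ idm

module _ {o ℓ e} (C : Category o ℓ e) where
  open Category C

  -- Monoidal structures whose tensor (on objects and on morphisms) and
  -- unit are the given ones.
  record MonoidalStructure
    (_⊗₀_ : Obj → Obj → Obj)
    (_⊗₁_ : ∀ {A A′ B B′} → A ⇒ A′ → B ⇒ B′ → (A ⊗₀ B) ⇒ (A′ ⊗₀ B′))
    (I : Obj) : Set (o ⊔ ℓ ⊔ e) where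
    field
      ⊗-resp-≈ : ∀ {A A′ B B′} {f f′ : A ⇒ A′} {g g′ : B ⇒ B′} →
                 f ≈ f′ → g ≈ g′ → (f ⊗₁ g) ≈ (f′ ⊗₁ g′)
      ⊗-id     : ∀ {A B} → (idm {A} ⊗₁ idm {B}) ≈ idm
      ⊗-∘      : ∀ {A A′ A″ B B′ B″}
                 {f : A ⇒ A′} {f′ : A′ ⇒ A″} {g : B ⇒ B′} {g′ : B′ ⇒ B″} →
                 ((f′ ⊙ f) ⊗₁ (g′ ⊙ g)) ≈ (f′ ⊗₁ g′) ⊙ (f ⊗₁ g)

      λ⇒ : ∀ {A} → (I ⊗₀ A) ⇒ A
      λ⇐ : ∀ {A} → A ⇒ (I ⊗₀ A)
      ρ⇒ : ∀ {A} → (A ⊗₀ I) ⇒ A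
      ρ⇐ : ∀ {A} → A ⇒ (A ⊗₀ I)
      α⇒ : ∀ {A B D} → ((A ⊗₀ B) ⊗₀ D) ⇒ (A ⊗₀ (B ⊗₀ D))
      α⇐ : ∀ {A B D} → (A ⊗₀ (B ⊗₀ D)) ⇒ ((A ⊗₀ B) ⊗₀ D)

      λ-inverse : ∀ {A} → IsInverse (λ⇒ {A}) λ⇐
      ρ-inverse : ∀ {A} → IsInverse (ρ⇒ {A}) ρ⇐
      α-inverse : ∀ {A B D} → IsInverse (α⇒ {A} {B} {D}) α⇐

      λ-natural : ∀ {A A′} {f : A ⇒ A′} → λ⇒ ⊙ (idm ⊗₁ f) ≈ f ⊙ λ⇒
      ρ-natural : ∀ {A A′} {f : A ⇒ A′} → ρ⇒ ⊙ (f ⊗₁ idm) ≈ f ⊙ ρ⇒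
      α-natural : ∀ {A A′ B B′ D D′} {f : A ⇒ A′} {g : B ⇒ B′} {h : D ⇒ D′} →
                  α⇒ ⊙ ((f ⊗₁ g) ⊗₁ h) ≈ (f ⊗₁ (g ⊗₁ h)) ⊙ α⇒

      triangle : ∀ {A B} →
                 (idm {A} ⊗₁ λ⇒ {B}) ⊙ α⇒ ≈ ρ⇒ ⊗₁ idm
      pentagon : ∀ {A B D E} →
                 (idm {A} ⊗₁ α⇒ {B} {D} {E}) ⊙ (α⇒ ⊙ (α⇒ ⊗₁ idm)) ≈ α⇒ ⊙ α⇒

  -- Each functor - ⊗ B has the right adjoint [ B , - ], naturally in B.
  record RightClosedStructure
    (_⊗₀_ : Obj → Obj → Obj)
    (_⊗₁_ : ∀ {A A′ B B′} → A ⇒ A′ → B ⇒ B′ → (A ⊗₀ B) ⇒ (A′ ⊗₀ B′))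
    ([_,_]₀ : Obj → Obj → Obj)
    ([_,_]₁ : ∀ {B B′ D D′} → B′ ⇒ B → D ⇒ D′ → [ B , D ]₀ ⇒ [ B′ , D′ ]₀)
    : Set (o ⊔ ℓ ⊔ e) where
    field
      hom-resp-≈ : ∀ {B B′ D D′} {f f′ : B′ ⇒ B} {g g′ : D ⇒ D′} →
                   f ≈ f′ → g ≈ g′ → [ f , g ]₁ ≈ [ f′ , g′ ]₁
      hom-id     : ∀ {B D} → [ idm {B} , idm {D} ]₁ ≈ idm
      hom-∘      : ∀ {B B′ B″ D D′ D″}
                   {f : B′ ⇒ B} {f′ : B″ ⇒ B′} {g : D ⇒ D′} {g′ : D′ ⇒ D″} →
                   [ f ⊙ f′ , g′ ⊙ g ]₁ ≈ [ f′ , g′ ]₁ ⊙ [ f , g ]₁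

      adjunction : ∀ A B D →
                   Inverse (hom-setoid (A ⊗₀ B) D) (hom-setoid A [ B , D ]₀)

    transpose : ∀ {A B D} → (A ⊗₀ B) ⇒ D → A ⇒ [ B , D ]₀
    transpose {A} {B} {D} = Inverse.to (adjunction A B D)

    field
      adjunction-natural :
        ∀ {A A′ B B′ D D′} (f : A′ ⇒ A) (g : B′ ⇒ B) (h : D ⇒ D′)
        (k : (A ⊗₀ B) ⇒ D) →
        transpose (h ⊙ (k ⊙ (f ⊗₁ g))) ≈ [ g , h ]₁ ⊙ (transpose k ⊙ f)

------------------------------------------------------------------------
-- Covariant presheaves.  Setoids play the role of sets, so that the
-- quotients forming coends exist.

module _ (C : Category 0ℓ 0ℓ 0ℓ) where
  open Category C

  record Presheaf : Set₁ where
    field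
      ob : Obj → Setoid 0ℓ 0ℓ

    El : Obj → Set
    El A = Setoid.Carrier (ob A)

    infix 4 Eq
    Eq : ∀ A → El A → El A → Set
    Eq A = Setoid._≈_ (ob A)

    syntax Eq A x y = x ≈[ A ] y

    field
      act      : ∀ {A B} → A ⇒ B → El A → El B
      act-cong : ∀ {A B} {f g : A ⇒ B} {x y : El A} →
                 f ≈ g → x ≈[ A ] y → act f x ≈[ B ] act g y
      act-id   : ∀ {A} {x : El A} → act idm x ≈[ A ] x
      act-∘    : ∀ {A B D} {f : A ⇒ B} {g : B ⇒ D} {x : El A} →
                 act (g ⊙ f) x ≈[ D ] act g (act f x)

    module Eqv {A} = IsEquivalence (Setoid.isEquivalence (ob A))

  record Nat (X Y : Presheaf) : Set where
    private
      module X = Presheaf X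
      module Y = Presheaf Y
    field
      η       : ∀ {A} → X.El A → Y.El A
      η-cong  : ∀ {A} {x y : X.El A} → X.Eq A x y → Y.Eq A (η x) (η y)
      natural : ∀ {A B} (f : A ⇒ B) (x : X.El A) →
                Y.Eq B (η (X.act f x)) (Y.act f (η x))

  module _ {X Y : Presheaf} where
    private
      module X = Presheaf X
      module Y = Presheaf Y
    open Nat

    infix 4 _≈ⁿ_
    _≈ⁿ_ : Nat X Y → Nat X Y → Set
    φ ≈ⁿ ψ = ∀ A (x : X.El A) → Y.Eq A (η φ x) (η ψ x)

    ≈ⁿ-isEquivalence : IsEquivalence _≈ⁿ_
    ≈ⁿ-isEquivalence = record
      { refl  = λ _ _ → Y.Eqv.refl
      ; sym   = λ p A x → Y.Eqv.sym (p A x)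
      ; trans = λ p q A x → Y.Eqv.trans (p A x) (q A x)
      }

  idⁿ : ∀ {X} → Nat X X
  idⁿ {X} = record
    { η = id ; η-cong = id ; natural = λ _ _ → Presheaf.Eqv.refl X }

  infixr 9 _∘ⁿ_
  _∘ⁿ_ : ∀ {X Y Z} → Nat Y Z → Nat X Y → Nat X Z
  _∘ⁿ_ {Z = Z} ψ φ = record
    { η       = λ x → η ψ (η φ x)
    ; η-cong  = λ p → η-cong ψ (η-cong φ p)
    ; natural = λ f x → Presheaf.Eqv.trans Z
                          (η-cong ψ (natural φ f x)) (natural ψ f (η φ x))
    }
    where open Nat

  PSh : Category (lsuc 0ℓ) 0ℓ 0ℓ
  PSh = record
    { Obj       = Presheaf
    ; _⇒_       = Nat
    ; _≈_       = _≈ⁿ_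
    ; idm       = idⁿ
    ; _⊙_       = _∘ⁿ_
    ; equiv     = ≈ⁿ-isEquivalence
    ; identityˡ = λ {_} {Y} _ _ → Presheaf.Eqv.refl Y
    ; identityʳ = λ {_} {Y} _ _ → Presheaf.Eqv.refl Y
    ; assoc     = λ {_} {_} {_} {Z} _ _ → Presheaf.Eqv.refl Z
    ; ⊙-resp-≈  = λ {_} {_} {Z} {f} p q A x →
                    Presheaf.Eqv.trans Z (Nat.η-cong f (q A x)) (p A _)
    }

------------------------------------------------------------------------
-- 𝔽 is the skeletal category with objects n : ℕ, a map m → n being a
-- function Fin m → Fin n up to pointwise equality.

infixr 6 _⊕_
_⊕_ : ∀ {m n k l} → (Fin m → Fin k) → (Fin n → Fin l) → Fin (m + n) → Fin (k + l)
_⊕_ {m} {n} {k} {l} f g i = join k l (Sum.map f g (splitAt m i))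

record IsPullback {P X B Y : ℕ}
  (p : Fin P → Fin X) (q : Fin P → Fin B)
  (f : Fin X → Fin Y) (b : Fin B → Fin Y) : Set where
  field
    commutes  : f ∘ p ≗ b ∘ q
    universal : ∀ {K} (u : Fin K → Fin X) (v : Fin K → Fin B) → f ∘ u ≗ b ∘ v →
                Σ[ w ∈ (Fin K → Fin P) ] (p ∘ w ≗ u × q ∘ w ≗ v)
    unique    : ∀ {K} (w w′ : Fin K → Fin P) →
                p ∘ w ≗ p ∘ w′ → q ∘ w ≗ q ∘ w′ → w ≗ w′

-- Wideness is built in: every n : ℕ is an object of the subcategory.
-- Pullback stability refers to all pullback squares of 𝔽, not just to chosen
-- ones, so every bijection belongs to the subcategory.
record ContextualSubcategory : Set₁ where
  field
    InCtx           : ∀ {m n} → (Fin m → Fin n) → Set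
    resp-≗          : ∀ {m n} {f g : Fin m → Fin n} → f ≗ g → InCtx f → InCtx g
    id-closed       : ∀ {m} → InCtx (id {A = Fin m})
    ∘-closed        : ∀ {m n k} {g : Fin n → Fin k} {f : Fin m → Fin n} →
                      InCtx g → InCtx f → InCtx (g ∘ f)
    +-closed        : ∀ {m n k l} {f : Fin m → Fin k} {g : Fin n → Fin l} →
                      InCtx f → InCtx g → InCtx (f ⊕ g)
    pullback-stable : ∀ {P X B Y} {p : Fin P → Fin X} {q : Fin P → Fin B}
                      {f : Fin X → Fin Y} {b : Fin B → Fin Y} →
                      IsPullback p q f b → InCtx f → InCtx q

------------------------------------------------------------------------
-- Decidable subsets of a listed finite set, as objects of 𝔽

lookup-injective : ∀ {A : Set} {xs : List A} → Unique xs →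
                   ∀ i j → lookup xs i ≡ lookup xs j → i ≡ j
lookup-injective {xs = _ ∷ _}  _        zero    zero    _ = refl
lookup-injective {xs = _ ∷ xs} (x∉ ∷ _) zero    (suc j) e =
  contradiction e (All.lookup x∉ (∈-lookup {xs = xs} j))
lookup-injective {xs = _ ∷ xs} (x∉ ∷ _) (suc i) zero    e =
  contradiction (sym e) (All.lookup x∉ (∈-lookup {xs = xs} i))
lookup-injective {xs = _ ∷ _}  (_ ∷ u)  (suc i) (suc j) e =
  cong suc (lookup-injective u i j e)

module Subset {A : Set} {P : Pred A 0ℓ} (P? : Decidable P) {xs : List A}
              (xs-unique : Unique xs) (xs-complete : ∀ x → x ∈ xs) where

  -- Opaque only to keep the enumeration from unfolding during type checking.
  opaque
    size : ℕ
    size = length (filter P? xs)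

    incl : Fin size → A
    incl = lookup (filter P? xs)

    incl-holds : ∀ i → P (incl i)
    incl-holds i = proj₂ (∈-filter⁻ P? {xs = xs} (∈-lookup i))

    code : ∀ x → P x → Fin size
    code x px = index (∈-filter⁺ P? (xs-complete x) px)

    incl-code : ∀ x (px : P x) → incl (code x px) ≡ x
    incl-code x px = sym (lookup-index (∈-filter⁺ P? (xs-complete x) px))

    incl-injective : ∀ {i j} → incl i ≡ incl j → i ≡ j
    incl-injective = lookup-injective (filter⁺ P? xs-unique) _ _

module Fibre {B A : ℕ} (b : Fin B → Fin A) (a : Fin A) =
  Subset (λ x → b x ≟ a) (allFin⁺ B) ∈-allFin

infix 8 _⁻¹_
_⁻¹_ : ∀ {B A} → (Fin B → Fin A) → Fin A → ℕ
b ⁻¹ a = Fibre.size b a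

module Pullback {A′ B A : ℕ} (f : Fin A′ → Fin A) (b : Fin B → Fin A) where

  private
    module S = Subset (λ (xy : Fin A′ × Fin B) → f (proj₁ xy) ≟ b (proj₂ xy))
                 (cartesianProduct⁺ (allFin⁺ A′) (allFin⁺ B))
                 (λ xy → ∈-cartesianProduct⁺ (∈-allFin (proj₁ xy)) (∈-allFin (proj₂ xy)))

  apex : ℕ
  apex = S.size

  π₁ : Fin apex → Fin A′
  π₁ z = proj₁ (S.incl z)

  π₂ : Fin apex → Fin B
  π₂ z = proj₂ (S.incl z)

  square : f ∘ π₁ ≗ b ∘ π₂
  square = S.incl-holds

  pair : ∀ x y → f x ≡ b y → Fin apex
  pair x y e = S.code (x , y) e

  π₁-pair : ∀ x y e → π₁ (pair x y e) ≡ x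
  π₁-pair x y e = cong proj₁ (S.incl-code (x , y) e)

  π₂-pair : ∀ x y e → π₂ (pair x y e) ≡ y
  π₂-pair x y e = cong proj₂ (S.incl-code (x , y) e)

  π-injective : ∀ {z w} → π₁ z ≡ π₁ w → π₂ z ≡ π₂ w → z ≡ w
  π-injective p q = S.incl-injective (cong₂ _,_ p q)

------------------------------------------------------------------------

module Substitution (𝒞 : ContextualSubcategory) where
  open ContextualSubcategory 𝒞

  -- Equality of maps (_≈ᶜ_) ignores the membership proof.
  record Hom (m n : ℕ) : Set where
    constructor _,_
    field
      fun : Fin m → Fin n
      mem : InCtx fun
  open Hom public

  infixr 9 _∘ᶜ_
  _∘ᶜ_ : ∀ {m n k} → Hom n k → Hom m n → Hom m k
  g ∘ᶜ f = (fun g ∘ fun f) , ∘-closed (mem g) (mem f)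

  idᶜ : ∀ {m} → Hom m m
  idᶜ = id , id-closed

  infix 4 _≈ᶜ_
  _≈ᶜ_ : ∀ {m n} → Hom m n → Hom m n → Set
  f ≈ᶜ g = fun f ≗ fun g

  Ctx : Category 0ℓ 0ℓ 0ℓ
  Ctx = record
    { Obj       = ℕ
    ; _⇒_       = Hom
    ; _≈_       = _≈ᶜ_
    ; idm       = idᶜ
    ; _⊙_       = _∘ᶜ_
    ; equiv     = record { refl  = λ _ → refl ; sym = λ p i → sym (p i)
                         ; trans = λ p q i → trans (p i) (q i) }
    ; identityˡ = λ _ → refl
    ; identityʳ = λ _ → refl
    ; assoc     = λ _ → refl
    ; ⊙-resp-≈  = λ {_} {_} {_} {f} p q i → trans (cong (fun f) (q i)) (p _)
    }

  [Ctx,Set] : Category (lsuc 0ℓ) 0ℓ 0ℓ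
  [Ctx,Set] = PSh Ctx

  private
    PS : Set₁
    PS = Presheaf Ctx

    _⇛_ : PS → PS → Set
    _⇛_ = Nat Ctx

  open Presheaf
  open Nat

  act-comp : ∀ (X : PS) {A B C} {f : Hom A B} {g : Hom B C} {h : Hom A C} {x} →
             g ∘ᶜ f ≈ᶜ h → Eq X C (act X g (act X f x)) (act X h x)
  act-comp X e = Eqv.trans X (Eqv.sym X (act-∘ X)) (act-cong X e (Eqv.refl X))

  bijection-closed : ∀ {m n} (f : Fin m → Fin n) (g : Fin n → Fin m) →
                     f ∘ g ≗ id → g ∘ f ≗ id → InCtx f
  bijection-closed f g fg gf = pullback-stable {p = f} {f = id} {b = id} (record
    { commutes  = λ _ → refl
    ; universal = λ u v e → g ∘ u , (λ i → fg (u i)) , (λ i → trans (fg (u i)) (e i))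
    ; unique    = λ w w′ p _ i → trans (sym (gf (w i))) (trans (cong g (p i)) (gf (w′ i)))
    }) id-closed

  y : ℕ → PS
  y B = record
    { ob       = Category.hom-setoid Ctx B
    ; act      = _∘ᶜ_
    ; act-cong = λ {_} {_} {f} {g} {x} {y} p q i → trans (p _) (cong (fun g) (q i))
    ; act-id   = λ _ → refl
    ; act-∘    = λ _ → refl
    }

  V : PS
  V = y 1

  ----------------------------------------------------------------------
  -- The restriction j_a : B_a → B′_a of a map j over A

  module _ {A B B′} {b : Fin B → Fin A} {b′ : Fin B′ → Fin A}
           (j : Hom B B′) (over : b′ ∘ fun j ≗ b) (a : Fin A) where
    private
      module F  = Fibre b a
      module F′ = Fibre b′ a

    restrict-fun : Fin (b ⁻¹ a) → Fin (b′ ⁻¹ a)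
    restrict-fun i = F′.code (fun j (F.incl i)) (trans (over _) (F.incl-holds i))

    incl-restrict : ∀ i → F′.incl (restrict-fun i) ≡ fun j (F.incl i)
    incl-restrict i = F′.incl-code _ _

    opaque
      restrict-mem : InCtx restrict-fun
      restrict-mem = pullback-stable {p = F.incl} {f = fun j} {b = F′.incl} (record
        { commutes  = λ i → sym (incl-restrict i)
        ; universal = λ u v e →
            let c : ∀ k → b (u k) ≡ a
                c k = trans (sym (over _)) (trans (cong b′ (e k)) (F′.incl-holds (v k)))
                w = λ k → F.code (u k) (c k)
            in w , (λ k → F.incl-code (u k) (c k))
                 , (λ k → F′.incl-injective
                     (trans (incl-restrict (w k))
                       (trans (cong (fun j) (F.incl-code (u k) (c k))) (e k))))
        ; unique    = λ w w′ p _ k → F.incl-injective (p k)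
        }) (mem j)

    restrict : Hom (b ⁻¹ a) (b′ ⁻¹ a)
    restrict = restrict-fun , restrict-mem

  ----------------------------------------------------------------------
  -- A ◁ X.  A representative [g , (t_a)] consists of proj : B → A in 𝔽,
  -- head = g : B → C in Ctx and terms t_a ∈ X B_a, where B = dom.

  record Rep (A : ℕ) (X : PS) (C : ℕ) : Set where
    constructor ⟪_,_,_⟫
    field
      {dom} : ℕ
      proj  : Fin dom → Fin A
      head  : Hom dom C
      terms : ∀ a → El X (proj ⁻¹ a)
  open Rep public

  -- The generator [g′ ∘ j , t] = [g′ , j · t].  The equations
  -- head γ ≈ g′ ∘ j and j · t ≈ terms γ′ are up to the equality of the
  -- setoids, which makes this relation (with j = id) contain the equality
  -- of representatives.
  record Step {A : ℕ} {X : PS} {C : ℕ} (γ γ′ : Rep A X C) : Set where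
    field
      j        : Hom (dom γ) (dom γ′)
      over     : proj γ′ ∘ fun j ≗ proj γ
      head-eq  : head γ ≈ᶜ head γ′ ∘ᶜ j
      terms-eq : ∀ a → Eq X (proj γ′ ⁻¹ a) (act X (restrict j over a) (terms γ a)) (terms γ′ a)

  restrict-id : ∀ (X : PS) {A B} {b : Fin B → Fin A} (over : b ∘ id ≗ b) a {x} →
                Eq X (b ⁻¹ a) (act X (restrict {b = b} {b′ = b} idᶜ over a) x) x
  restrict-id X {b = b} over a =
    Eqv.trans X
      (act-cong X (λ i → Fibre.incl-injective b a (incl-restrict idᶜ over a i)) (Eqv.refl X))
      (act-id X)

  same-proj : ∀ {A X C B} {b : Fin B → Fin A} {g g′ : Hom B C} {t t′ : ∀ a → El X (b ⁻¹ a)} →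
              g ≈ᶜ g′ → (∀ a → Eq X (b ⁻¹ a) (t a) (t′ a)) →
              Step {A} {X} {C} ⟪ b , g , t ⟫ ⟪ b , g′ , t′ ⟫
  same-proj {X = X} p q = record
    { j        = idᶜ
    ; over     = λ _ → refl
    ; head-eq  = p
    ; terms-eq = λ a → Eqv.trans X (restrict-id X (λ _ → refl) a) (q a)
    }

  infixr 7 _◁_
  _◁_ : ℕ → PS → PS
  A ◁ X = record
    { ob       = λ C → EqC.setoid (Step {A} {X} {C})
    ; act      = post
    ; act-cong = λ {_} {_} {f} {g} {γ} {δ} p q →
        EqC.transitive Step
          (EqC.return (same-proj (λ i → p _) (λ _ → Eqv.refl X)))
          (EqC.gmap (post g) post-step q)
    ; act-id   = EqC.return (same-proj (λ _ → refl) (λ _ → Eqv.refl X))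
    ; act-∘    = EqC.return (same-proj (λ _ → refl) (λ _ → Eqv.refl X))
    }
    where
    post : ∀ {C D} → Hom C D → Rep A X C → Rep A X D
    post f ⟪ b , g , t ⟫ = ⟪ b , f ∘ᶜ g , t ⟫

    post-step : ∀ {C D} {f : Hom C D} {γ δ} → Step γ δ → Step (post f γ) (post f δ)
    post-step {f = f} s = record
      { j        = Step.j s
      ; over     = Step.over s
      ; head-eq  = λ i → cong (fun f) (Step.head-eq s i)
      ; terms-eq = Step.terms-eq s
      }

  ----------------------------------------------------------------------
  -- The contravariant action of f : A′ → A in Ctx.

  -- The canonical map B_{f a′} → (f^*B)_{a′}, which is a bijection.
  module _ {A′ A B} (f : Fin A′ → Fin A) (b : Fin B → Fin A) (a′ : Fin A′) where
    private
      module Q = Pullback f b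
      module F = Fibre b (f a′)
      module G = Fibre Q.π₁ a′

      to : Fin (b ⁻¹ f a′) → Fin (Q.π₁ ⁻¹ a′)
      to i = G.code (Q.pair a′ (F.incl i) (sym (F.incl-holds i))) (Q.π₁-pair _ _ _)

      from-holds : ∀ k → b (Q.π₂ (G.incl k)) ≡ f a′
      from-holds k = trans (sym (Q.square (G.incl k))) (cong f (G.incl-holds k))

      from : Fin (Q.π₁ ⁻¹ a′) → Fin (b ⁻¹ f a′)
      from k = F.code (Q.π₂ (G.incl k)) (from-holds k)

      π₂-to : ∀ i → Q.π₂ (G.incl (to i)) ≡ F.incl i
      π₂-to i = trans (cong Q.π₂ (G.incl-code _ _)) (Q.π₂-pair _ _ _)

      incl-from : ∀ k → F.incl (from k) ≡ Q.π₂ (G.incl k)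
      incl-from k = F.incl-code _ _

    reindexed-injective : ∀ {k l} → Q.π₂ (G.incl k) ≡ Q.π₂ (G.incl l) → k ≡ l
    reindexed-injective {k} {l} e = G.incl-injective
      (Q.π-injective (trans (G.incl-holds k) (sym (G.incl-holds l))) e)

    opaque
      reindex-mem : InCtx to
      reindex-mem = bijection-closed to from
        (λ k → reindexed-injective (trans (π₂-to (from k)) (incl-from k)))
        (λ i → F.incl-injective (trans (incl-from (to i)) (π₂-to i)))

    reindex : Hom (b ⁻¹ f a′) (Q.π₁ ⁻¹ a′)
    reindex = to , reindex-mem

    π₂-reindex : ∀ i → Q.π₂ (G.incl (fun reindex i)) ≡ F.incl i
    π₂-reindex = π₂-to

  pullback-isPullback : ∀ {A′ A B} (f : Fin A′ → Fin A) (b : Fin B → Fin A) →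
    IsPullback (Pullback.π₁ f b) (Pullback.π₂ f b) f b
  pullback-isPullback f b = record
    { commutes  = Q.square
    ; universal = λ u v e → (λ k → Q.pair (u k) (v k) (e k))
                          , (λ k → Q.π₁-pair _ _ (e k)) , (λ k → Q.π₂-pair _ _ (e k))
    ; unique    = λ _ _ p q k → Q.π-injective (p k) (q k)
    }
    where module Q = Pullback f b

  opaque
    r-mem : ∀ {A′ A B} (f : Hom A′ A) (b : Fin B → Fin A) → InCtx (Pullback.π₂ (fun f) b)
    r-mem f b = pullback-stable (pullback-isPullback (fun f) b) (mem f)

  rᶜ : ∀ {A′ A B} (f : Hom A′ A) (b : Fin B → Fin A) → Hom (Pullback.apex (fun f) b) B
  rᶜ f b = Pullback.π₂ (fun f) b , r-mem f b

  -- [g , (t_a)] · f = [g ∘ r_f , (t_{f a′})], with t_{f a′} ∈ X B_{f a′}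
  -- transported along B_{f a′} ≅ (f^*B)_{a′}.
  infixl 8 _·_
  _·_ : ∀ {A′ A X C} → Rep A X C → Hom A′ A → Rep A′ X C
  _·_ {X = X} ⟪ b , g , t ⟫ f =
    ⟪ Pullback.π₁ (fun f) b
    , g ∘ᶜ rᶜ f b
    , (λ a′ → act X (reindex (fun f) b a′) (t (fun f a′)))
    ⟫

  -- f^*j : f^*B → f^*B′, a pullback of j along f^*B′ → B′
  module Pulled {A′ A B B′} (f : Fin A′ → Fin A)
                (b : Fin B → Fin A) (b′ : Fin B′ → Fin A) (j : Hom B B′) (over : b′ ∘ fun j ≗ b) where
    module Q  = Pullback f b
    module Q′ = Pullback f b′

    pulled-fun : Fin Q.apex → Fin Q′.apex
    pulled-fun z = Q′.pair (Q.π₁ z) (fun j (Q.π₂ z)) (trans (Q.square z) (sym (over _)))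

    pulled-π₁ : Q′.π₁ ∘ pulled-fun ≗ Q.π₁
    pulled-π₁ z = Q′.π₁-pair _ _ _

    pulled-π₂ : Q′.π₂ ∘ pulled-fun ≗ fun j ∘ Q.π₂
    pulled-π₂ z = Q′.π₂-pair _ _ _

    opaque
      pulled-mem : InCtx pulled-fun
      pulled-mem = pullback-stable {p = Q.π₂} {f = fun j} {b = Q′.π₂} (record
        { commutes  = λ z → sym (pulled-π₂ z)
        ; universal = λ u v e →
            let c : ∀ k → f (Q′.π₁ (v k)) ≡ b (u k)
                c k = trans (Q′.square (v k)) (trans (cong b′ (sym (e k))) (over (u k)))
                w = λ k → Q.pair (Q′.π₁ (v k)) (u k) (c k)
            in w , (λ k → Q.π₂-pair _ _ (c k))
                 , (λ k → Q′.π-injective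
                     (trans (pulled-π₁ (w k)) (Q.π₁-pair _ _ (c k)))
                     (trans (pulled-π₂ (w k)) (trans (cong (fun j) (Q.π₂-pair _ _ (c k))) (e k))))
        ; unique    = λ w w′ p q k → Q.π-injective
            (trans (sym (pulled-π₁ (w k))) (trans (cong Q′.π₁ (q k)) (pulled-π₁ (w′ k))))
            (p k)
        }) (mem j)

    pulled : Hom Q.apex Q′.apex
    pulled = pulled-fun , pulled-mem

  ·-step : ∀ {A′ A X C} (f : Hom A′ A) {γ δ : Rep A X C} → Step γ δ → Step (γ · f) (δ · f)
  ·-step {X = X} f {γ} {δ} s = record
    { j        = pulled
    ; over     = pulled-π₁
    ; head-eq  = λ z → trans (S.head-eq _) (cong (fun (head δ)) (sym (pulled-π₂ z)))
    ; terms-eq = λ a′ → Eqv.trans X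
        (Eqv.trans X
          (act-comp X {h = reindex (fun f) (proj δ) a′ ∘ᶜ restrict S.j S.over (fun f a′)} (square a′))
          (act-∘ X))
        (act-cong X (λ _ → refl) (S.terms-eq (fun f a′)))
    }
    where
    module S = Step s
    open Pulled (fun f) (proj γ) (proj δ) S.j S.over

    square : ∀ a′ →
      restrict pulled pulled-π₁ a′ ∘ᶜ reindex (fun f) (proj γ) a′
      ≈ᶜ reindex (fun f) (proj δ) a′ ∘ᶜ restrict S.j S.over (fun f a′)
    square a′ i = reindexed-injective (fun f) (proj δ) a′
      (trans (cong Q′.π₂ (incl-restrict pulled pulled-π₁ a′ _))
      (trans (pulled-π₂ _)
      (trans (cong (fun S.j) (π₂-reindex (fun f) (proj γ) a′ i))
      (trans (sym (incl-restrict S.j S.over (fun f a′) i))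
             (sym (π₂-reindex (fun f) (proj δ) a′ _))))))

  ·-cong : ∀ {A′ A X C} (f : Hom A′ A) {γ δ : Rep A X C} →
           Eq (A ◁ X) C γ δ → Eq (A′ ◁ X) C (γ · f) (δ · f)
  ·-cong f {γ} {δ} = EqC.gmap {R = Step} {S = Step} (_· f) (λ {γ} {δ} → ·-step f {γ} {δ}) {γ} {δ}

  -- A generator from γ · f to δ, given on fibres by maps m out of B_{f a′}
  -- (rather than out of (f^*B)_{a′}).
  ·-to : ∀ {A′ A X C} (f : Hom A′ A) (γ : Rep A X C) (δ : Rep A′ X C)
    (k : Hom (Pullback.apex (fun f) (proj γ)) (dom δ))
    (over : proj δ ∘ fun k ≗ Pullback.π₁ (fun f) (proj γ)) →
    head γ ∘ᶜ rᶜ f (proj γ) ≈ᶜ head δ ∘ᶜ k →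
    (∀ a′ → Σ[ m ∈ Hom (proj γ ⁻¹ fun f a′) (proj δ ⁻¹ a′) ]
       ( (∀ i → fun k (Fibre.incl (Pullback.π₁ (fun f) (proj γ)) a′
                        (fun (reindex (fun f) (proj γ) a′) i))
                ≡ Fibre.incl (proj δ) a′ (fun m i))
       × Eq X (proj δ ⁻¹ a′) (act X m (terms γ (fun f a′))) (terms δ a′))) →
    Step (γ · f) δ
  ·-to {X = X} f γ δ k over h c = record
    { j        = k
    ; over     = over
    ; head-eq  = h
    ; terms-eq = λ a′ → let (m , p , q) = c a′ in
        Eqv.trans X
          (act-comp X {h = m} (λ i → Fibre.incl-injective (proj δ) a′
            (trans (incl-restrict k over a′ _) (p i))))
          q
    }

  ·-id : ∀ {A X C} (γ : Rep A X C) → Step (γ · idᶜ) γ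
  ·-id {X = X} γ = ·-to idᶜ γ γ (rᶜ idᶜ (proj γ))
    (λ z → sym (Pullback.square id (proj γ) z))
    (λ _ → refl)
    (λ a → idᶜ , π₂-reindex id (proj γ) a , act-id X)

  ·-∘ : ∀ {A″ A′ A X C} (f : Hom A′ A) (f′ : Hom A″ A′) (γ : Rep A X C) →
        Step (γ · (f ∘ᶜ f′)) (γ · f · f′)
  ·-∘ {X = X} f f′ γ = ·-to (f ∘ᶜ f′) γ (γ · f · f′) (k , bijection-closed k l kl lk)
    k-π₁
    (λ z → cong (fun (head γ)) (sym (k-π₂ z)))
    (λ a″ → reindex (fun f′) Q.π₁ a″ ∘ᶜ reindex (fun f) b (fun f′ a″)
          , (λ i → Q′.π-injective
              (trans (k-π₁ _) (trans (Fibre.incl-holds P.π₁ a″ _)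
                (sym (Fibre.incl-holds Q′.π₁ a″ _))))
              (Q.π-injective
                (trans (k-π₂₁ _) (trans (cong (fun f′) (Fibre.incl-holds P.π₁ a″ _))
                  (sym (trans (cong Q.π₁ (π₂-reindex (fun f′) Q.π₁ a″ _))
                              (Fibre.incl-holds Q.π₁ (fun f′ a″) _)))))
                (trans (k-π₂ _) (trans (π₂-reindex (fun (f ∘ᶜ f′)) b a″ i)
                  (sym (trans (cong Q.π₂ (π₂-reindex (fun f′) Q.π₁ a″ _))
                              (π₂-reindex (fun f) b (fun f′ a″) i)))))))
          , act-∘ X)
    where
    b = proj γ
    module P  = Pullback (fun (f ∘ᶜ f′)) b
    module Q  = Pullback (fun f) b
    module Q′ = Pullback (fun f′) Q.π₁

    k : Fin P.apex → Fin Q′.apex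
    k z = Q′.pair (P.π₁ z) (Q.pair (fun f′ (P.π₁ z)) (P.π₂ z) (P.square z))
                  (sym (Q.π₁-pair _ _ _))

    l : Fin Q′.apex → Fin P.apex
    l w = P.pair (Q′.π₁ w) (Q.π₂ (Q′.π₂ w))
                 (trans (cong (fun f) (Q′.square w)) (Q.square (Q′.π₂ w)))

    k-π₁ : Q′.π₁ ∘ k ≗ P.π₁
    k-π₁ z = Q′.π₁-pair _ _ _

    k-π₂₁ : Q.π₁ ∘ Q′.π₂ ∘ k ≗ fun f′ ∘ P.π₁
    k-π₂₁ z = trans (cong Q.π₁ (Q′.π₂-pair _ _ _)) (Q.π₁-pair _ _ _)

    k-π₂ : Q.π₂ ∘ Q′.π₂ ∘ k ≗ P.π₂
    k-π₂ z = trans (cong Q.π₂ (Q′.π₂-pair _ _ _)) (Q.π₂-pair _ _ _)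

    l-π₁ : P.π₁ ∘ l ≗ Q′.π₁
    l-π₁ w = P.π₁-pair _ _ _

    l-π₂ : P.π₂ ∘ l ≗ Q.π₂ ∘ Q′.π₂
    l-π₂ w = P.π₂-pair _ _ _

    lk : l ∘ k ≗ id
    lk z = P.π-injective (trans (l-π₁ (k z)) (k-π₁ z)) (trans (l-π₂ (k z)) (k-π₂ z))

    kl : k ∘ l ≗ id
    kl w = Q′.π-injective (trans (k-π₁ (l w)) (l-π₁ w)) (Q.π-injective
      (trans (k-π₂₁ (l w)) (trans (cong (fun f′) (l-π₁ w)) (Q′.square w)))
      (trans (k-π₂ (l w)) (l-π₂ w)))

  fibre-cast : ∀ (X : PS) {A B} (b : Fin B → Fin A) (t : ∀ a → El X (b ⁻¹ a)) {a a′} → a ≡ a′ →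
    Σ[ m ∈ Hom (b ⁻¹ a) (b ⁻¹ a′) ]
      ((∀ i → Fibre.incl b a i ≡ Fibre.incl b a′ (fun m i))
       × Eq X (b ⁻¹ a′) (act X m (t a)) (t a′))
  fibre-cast X b t refl = idᶜ , (λ _ → refl) , act-id X

  ·-resp : ∀ {A′ A X C} {f f′ : Hom A′ A} → f ≈ᶜ f′ → (γ : Rep A X C) → Step (γ · f) (γ · f′)
  ·-resp {X = X} {f = f} {f′} e γ = ·-to f γ (γ · f′) (k , bijection-closed k l kl lk)
    k-π₁
    (λ z → cong (fun (head γ)) (sym (k-π₂ z)))
    (λ a′ → let (m , p , q) = fibre-cast X b (terms γ) (e a′) in
        reindex (fun f′) b a′ ∘ᶜ m
      , (λ i → reindexed-eq a′
          (trans (k-π₁ _) (Fibre.incl-holds P.π₁ a′ _))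
          (trans (k-π₂ _) (trans (π₂-reindex (fun f) b a′ i)
            (trans (p i) (sym (π₂-reindex (fun f′) b a′ _))))))
      , Eqv.trans X (act-∘ X) (act-cong X (λ _ → refl) q))
    where
    b = proj γ
    module P = Pullback (fun f) b
    module Q = Pullback (fun f′) b

    k : Fin P.apex → Fin Q.apex
    k z = Q.pair (P.π₁ z) (P.π₂ z) (trans (sym (e _)) (P.square z))

    l : Fin Q.apex → Fin P.apex
    l w = P.pair (Q.π₁ w) (Q.π₂ w) (trans (e _) (Q.square w))

    k-π₁ : Q.π₁ ∘ k ≗ P.π₁
    k-π₁ z = Q.π₁-pair _ _ _

    k-π₂ : Q.π₂ ∘ k ≗ P.π₂
    k-π₂ z = Q.π₂-pair _ _ _

    l-π₁ : P.π₁ ∘ l ≗ Q.π₁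
    l-π₁ w = P.π₁-pair _ _ _

    l-π₂ : P.π₂ ∘ l ≗ Q.π₂
    l-π₂ w = P.π₂-pair _ _ _

    lk : l ∘ k ≗ id
    lk z = P.π-injective (trans (l-π₁ (k z)) (k-π₁ z)) (trans (l-π₂ (k z)) (k-π₂ z))

    kl : k ∘ l ≗ id
    kl w = Q.π-injective (trans (k-π₁ (l w)) (l-π₁ w)) (trans (k-π₂ (l w)) (l-π₂ w))

    reindexed-eq : ∀ a′ {z} {i} → Q.π₁ z ≡ a′ → Q.π₂ z ≡ Q.π₂ (Fibre.incl Q.π₁ a′ i) →
                   z ≡ Fibre.incl Q.π₁ a′ i
    reindexed-eq a′ p q = Q.π-injective (trans p (sym (Fibre.incl-holds Q.π₁ a′ _))) q

  -- The functor (-) ◁ X : Ctx^op → [Ctx,Set] on morphisms.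
  ◁-pre : ∀ {A′ A} (X : PS) → Hom A′ A → (A ◁ X) ⇛ (A′ ◁ X)
  ◁-pre X f = record
    { η       = _· f
    ; η-cong  = ·-cong f
    ; natural = λ h γ → EqC.return (same-proj (λ _ → refl) (λ _ → Eqv.refl X))
    }

  -- The functor A ◁ (-) on morphisms: [g , t] ↦ [g , ψ ∘ t].
  infixr 7 _◁₁_
  _◁₁_ : ∀ A {X Y} → X ⇛ Y → (A ◁ X) ⇛ (A ◁ Y)
  _◁₁_ A {X} {Y} ψ = record
    { η       = mapRep
    ; η-cong  = EqC.gmap mapRep λ s → record
        { j        = Step.j s
        ; over     = Step.over s
        ; head-eq  = Step.head-eq s
        ; terms-eq = λ a → Eqv.trans Y (Eqv.sym Y (natural ψ _ _)) (η-cong ψ (Step.terms-eq s a))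
        }
    ; natural = λ f γ → EqC.return (same-proj (λ _ → refl) (λ _ → Eqv.refl Y))
    }
    where
    mapRep : ∀ {C} → Rep A X C → Rep A Y C
    mapRep ⟪ b , g , t ⟫ = ⟪ b , g , (λ a → η ψ (t a)) ⟫

  ◁₁-pre : ∀ {A′ A X Y C} (ψ : X ⇛ Y) (f : Hom A′ A) (γ : Rep A X C) →
           Step (η (A′ ◁₁ ψ) (γ · f)) (η (A ◁₁ ψ) γ · f)
  ◁₁-pre ψ f γ = same-proj (λ _ → refl) (λ a′ → natural ψ _ _)

  ----------------------------------------------------------------------
  -- X ◇ Y.  Representatives [x , γ] with x ∈ X A, γ ∈ (A ◁ Y) C, A = mid.

  record Tens (X Y : PS) (C : ℕ) : Set where
    constructor ⟦_,_⟧
    field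
      {mid} : ℕ
      elt   : El X mid
      sub   : Rep mid Y C
  open Tens public

  -- The generator (x , γ′ · j) ∼ (j · x , γ′), up to the equality of X
  -- and of mid ◁ Y.
  record TensStep {X Y : PS} {C : ℕ} (u v : Tens X Y C) : Set where
    field
      j      : Hom (mid u) (mid v)
      elt-eq : Eq X (mid v) (act X j (elt u)) (elt v)
      sub-eq : Eq (mid u ◁ Y) C (sub u) (sub v · j)

  same-mid : ∀ {X Y C A} {x x′ : El X A} {γ γ′ : Rep A Y C} →
             Eq X A x x′ → Eq (A ◁ Y) C γ γ′ → TensStep {X} {Y} {C} ⟦ x , γ ⟧ ⟦ x′ , γ′ ⟧
  same-mid {X} {γ′ = γ′} p q = record
    { j      = idᶜ
    ; elt-eq = Eqv.trans X (act-id X) p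
    ; sub-eq = EqC.transitive Step q (EqC.symmetric Step (EqC.return (·-id γ′)))
    }

  infixr 7 _◇_
  _◇_ : PS → PS → PS
  X ◇ Y = record
    { ob       = λ C → EqC.setoid (TensStep {X} {Y} {C})
    ; act      = post
    ; act-cong = λ {_} {_} {f} {g} {u} {v} p q →
        EqC.transitive TensStep
          (EqC.return (same-mid (Eqv.refl X) (act-cong (_ ◁ Y) p (Eqv.refl (_ ◁ Y)))))
          (EqC.gmap (post g) post-step q)
    ; act-id   = EqC.return (same-mid (Eqv.refl X) (act-id (_ ◁ Y)))
    ; act-∘    = EqC.return (same-mid (Eqv.refl X) (act-∘ (_ ◁ Y)))
    }
    where
    post : ∀ {C D} → Hom C D → Tens X Y C → Tens X Y D
    post f ⟦ x , γ ⟧ = ⟦ x , act (_ ◁ Y) f γ ⟧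

    post-step : ∀ {C D} {f : Hom C D} {u v} → TensStep u v → TensStep (post f u) (post f v)
    post-step {f = f} {u} {v} s = record
      { j      = S.j
      ; elt-eq = S.elt-eq
      ; sub-eq = EqC.transitive Step
          (act-cong (mid u ◁ Y) {f = f} (λ _ → refl) S.sub-eq)
          (EqC.symmetric Step (natural (◁-pre Y S.j) f (sub v)))
      }
      where module S = TensStep s

  -- [x , γ] ↦ [φ x , (A ◁ ψ) γ]
  infixr 7 _◇₁_
  _◇₁_ : ∀ {X X′ Y Y′} → X ⇛ X′ → Y ⇛ Y′ → (X ◇ Y) ⇛ (X′ ◇ Y′)
  _◇₁_ {X} {X′} {Y} {Y′} φ ψ = record
    { η       = mapTens
    ; η-cong  = EqC.gmap mapTens λ {u} {v} s → let module S = TensStep s in record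
        { j      = S.j
        ; elt-eq = Eqv.trans X′ (Eqv.sym X′ (natural φ _ _)) (η-cong φ S.elt-eq)
        ; sub-eq = EqC.transitive Step
            (η-cong (mid u ◁₁ ψ) S.sub-eq) (EqC.return (◁₁-pre ψ S.j (sub v)))
        }
    ; natural = λ f u → EqC.return
        (same-mid (Eqv.refl X′) (natural (mid u ◁₁ ψ) f (sub u)))
    }
    where
    mapTens : ∀ {C} → Tens X Y C → Tens X′ Y′ C
    mapTens ⟦ x , γ ⟧ = ⟦ η φ x , η (_ ◁₁ ψ) γ ⟧

  ----------------------------------------------------------------------
  -- [Y , Z]_◇ = Nat ((-) ◁ Y , Z)

  ⟨_,_⟩◇ : PS → PS → PS
  ⟨ Y , Z ⟩◇ = record
    { ob       = λ A → Category.hom-setoid [Ctx,Set] (A ◁ Y) Z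
    ; act      = λ f θ → _∘ⁿ_ Ctx θ (◁-pre Y f)
    ; act-cong = λ {_} {_} {f} {g} {θ} p q C γ →
        Eqv.trans Z (η-cong θ (EqC.return (·-resp p γ))) (q C _)
    ; act-id   = λ {_} {θ} C γ → η-cong θ (EqC.return (·-id γ))
    ; act-∘    = λ {_} {_} {_} {f} {g} {θ} C γ → η-cong θ (EqC.return (·-∘ g f γ))
    }

  -- θ ↦ χ ∘ θ ∘ (A ◁ ψ)
  ⟨_,_⟩◇₁ : ∀ {Y Y′ Z Z′} → Y′ ⇛ Y → Z ⇛ Z′ → ⟨ Y , Z ⟩◇ ⇛ ⟨ Y′ , Z′ ⟩◇
  ⟨_,_⟩◇₁ {Z = Z} {Z′} ψ χ = record
    { η       = λ {A} θ → _∘ⁿ_ Ctx χ (_∘ⁿ_ Ctx θ (A ◁₁ ψ))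
    ; η-cong  = λ p C γ → η-cong χ (p C _)
    ; natural = λ f θ C γ → η-cong χ (η-cong θ (EqC.symmetric Step (EqC.return (◁₁-pre ψ f γ))))
    }

{-# OPTIONS --safe #-}

-- A finite set B over A is a family (B_a), and by pullback stability and
-- closure under + a map over A is in Ctx iff all its restrictions are.  An
-- element of (A ◁ Y) C can therefore be given by the maps B_a → C and the
-- t_a ∈ Y B_a, with Σ_a B_a → C in Ctx; reindexing along f : A′ → A is then
-- literally composition with f.  In these terms the associator grafts families:
-- it collects, over each a, the fibres of the second family at the images of the
-- elements of B_a.  Its inverse takes disjoint unions over a; it respects the
-- quotients because A is finite, so that the terms may be changed one at a time.
-- The monoidal structure so obtained on the family tensor ◈ is transported to ◇
-- along a natural isomorphism, and closedness is currying of the coend.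

module Submission where

open import Axiom.UniquenessOfIdentityProofs using (module Decidable⇒UIP)
open import Data.Fin.Base using (Fin; zero; suc; splitAt; _↑ˡ_; _↑ʳ_)
open import Data.Fin.Properties using (_≟_; splitAt-↑ˡ; splitAt-↑ʳ; join-splitAt)
open import Data.Nat.Base using (ℕ; zero; suc; _+_)
open import Data.Product.Base as Product using (Σ; Σ-syntax; _×_; _,_; proj₁; proj₂)
open import Data.Product.Properties using (,-injectiveʳ-UIP)
open import Data.Sum.Base using (inj₁; inj₂; [_,_]′)
open import Function.Base using (_∘_; id)
open import Relation.Binary.Bundles using (Setoid)
open import Relation.Binary.Construct.Closure.Equivalence as EqC using (EqClosure)
open import Relation.Binary.PropositionalEquality
  using (_≡_; _≗_; refl; sym; trans; cong; subst)
import Relation.Binary.Reasoning.Setoid as SetoidReasoning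
open import Relation.Binary.Structures using (IsEquivalence)
open import Defs

-- Transport of a monoidal structure along a natural isomorphism of tensors

-- Only the map out of the whole sum of a family is required to lie in `Ctx`. Its restriction to one
-- summand need not, and maps in `Ctx` on the summands need not assemble to one, because `Ctx` may
-- lack points `1 → A` and codiagonals (the bijections form an example). Hence leaf maps are bare
-- functions, and membership is a condition on a tree as a whole, to be re-established for every
-- construction: pullback stability gives it for grafting, closure under `+` is added for disjoint
-- unions. The other obstacle is that the quotients are closures of generators and are nested. In
-- `(X ◈ Y) ◈ Z` one outer generator carries a whole chain between the roots, in `X ◈ (Y ◈ Z)` one
-- chain for each label. A map out of such a tensor therefore has to treat the chains separately
-- from the rest of the generator.

module _ {o ℓ e} (C : Category o ℓ e) where
  open Category C

  module Transport
    {_⊠₀_ : Obj → Obj → Obj}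
    {_⊠₁_ : ∀ {A A′ B B′} → A ⇒ A′ → B ⇒ B′ → (A ⊠₀ B) ⇒ (A′ ⊠₀ B′)}
    {I : Obj} (M : MonoidalStructure C _⊠₀_ _⊠₁_ I)
    {_⊗₀_ : Obj → Obj → Obj}
    {_⊗₁_ : ∀ {A A′ B B′} → A ⇒ A′ → B ⇒ B′ → (A ⊗₀ B) ⇒ (A′ ⊗₀ B′)}
    (θ : ∀ {A B} → (A ⊗₀ B) ⇒ (A ⊠₀ B)) (θ⁻ : ∀ {A B} → (A ⊠₀ B) ⇒ (A ⊗₀ B))
    (θ-inverse : ∀ {A B} → IsInverse (θ {A} {B}) θ⁻)
    (θ-natural : ∀ {A A′ B B′} {f : A ⇒ A′} {g : B ⇒ B′} → θ ⊙ (f ⊗₁ g) ≈ (f ⊠₁ g) ⊙ θ)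
    where

    private
      module M = MonoidalStructure M
      module E {A B} = IsEquivalence (equiv {A} {B})
      open module HomReasoning {A B} = SetoidReasoning (hom-setoid A B)

      infixr 7 refl⟩⊙⟨_ _⟩⊙⟨refl
      refl⟩⊙⟨_ : ∀ {A B D} {h : B ⇒ D} {f g : A ⇒ B} → f ≈ g → h ⊙ f ≈ h ⊙ g
      refl⟩⊙⟨ p = ⊙-resp-≈ E.refl p

      _⟩⊙⟨refl : ∀ {A B D} {h : A ⇒ B} {f g : B ⇒ D} → f ≈ g → f ⊙ h ≈ g ⊙ h
      p ⟩⊙⟨refl = ⊙-resp-≈ p E.refl

      pullˡ : ∀ {A B D F} {f : D ⇒ F} {g : B ⇒ D} {h : B ⇒ F} {k : A ⇒ B} →
              f ⊙ g ≈ h → f ⊙ (g ⊙ k) ≈ h ⊙ k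
      pullˡ p = E.trans (E.sym assoc) (p ⟩⊙⟨refl)

      extend : ∀ {A B D D′ F} {f : D ⇒ F} {g : B ⇒ D} {f′ : D′ ⇒ F} {g′ : B ⇒ D′} {k : A ⇒ B} →
               f ⊙ g ≈ f′ ⊙ g′ → f ⊙ (g ⊙ k) ≈ f′ ⊙ (g′ ⊙ k)
      extend p = E.trans (pullˡ p) assoc

      cancelˡ : ∀ {A B D} {f : B ⇒ D} {g : D ⇒ B} {k : A ⇒ D} → f ⊙ g ≈ idm → f ⊙ (g ⊙ k) ≈ k
      cancelˡ p = E.trans (pullˡ p) identityˡ

      ∘-inverse : ∀ {A B D} {f : A ⇒ B} {f⁻ : B ⇒ A} {g : B ⇒ D} {g⁻ : D ⇒ B} →
                  IsInverse g g⁻ → IsInverse f f⁻ → IsInverse (g ⊙ f) (f⁻ ⊙ g⁻)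
      ∘-inverse G F = record
        { invˡ = E.trans assoc (E.trans (refl⟩⊙⟨ cancelˡ (IsInverse.invˡ F)) (IsInverse.invˡ G))
        ; invʳ = E.trans assoc (E.trans (refl⟩⊙⟨ cancelˡ (IsInverse.invʳ G)) (IsInverse.invʳ F))
        }

      sym-inverse : ∀ {A B} {f : A ⇒ B} {g : B ⇒ A} → IsInverse f g → IsInverse g f
      sym-inverse F = record { invˡ = IsInverse.invʳ F ; invʳ = IsInverse.invˡ F }

      id-inverse : ∀ {A} → IsInverse (idm {A}) idm
      id-inverse = record { invˡ = identityˡ ; invʳ = identityˡ }

      ⊠-inverse : ∀ {A A′ B B′} {f : A ⇒ A′} {f⁻ : A′ ⇒ A} {g : B ⇒ B′} {g⁻ : B′ ⇒ B} →
                  IsInverse f f⁻ → IsInverse g g⁻ → IsInverse (f ⊠₁ g) (f⁻ ⊠₁ g⁻)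
      ⊠-inverse F G = record
        { invˡ = E.trans (E.sym M.⊗-∘)
            (E.trans (M.⊗-resp-≈ (IsInverse.invˡ F) (IsInverse.invˡ G)) M.⊗-id)
        ; invʳ = E.trans (E.sym M.⊗-∘)
            (E.trans (M.⊗-resp-≈ (IsInverse.invʳ F) (IsInverse.invʳ G)) M.⊗-id)
        }

      -- Equations for `⊗` are checked after composing with an invertible comparison, where
      -- `θ-natural` and the laws of `M` apply.
      monic : ∀ {A B D} {f : B ⇒ D} {f⁻ : D ⇒ B} {g h : A ⇒ B} →
              IsInverse f f⁻ → f ⊙ g ≈ f ⊙ h → g ≈ h
      monic F p = E.trans (E.sym (cancelˡ (IsInverse.invʳ F)))
                    (E.trans (refl⟩⊙⟨ p) (cancelˡ (IsInverse.invʳ F)))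

      ⊠-∘ˡ : ∀ {A A′ A″ B} {f : A ⇒ A′} {g : A′ ⇒ A″} → (g ⊠₁ idm {B}) ⊙ (f ⊠₁ idm) ≈ (g ⊙ f) ⊠₁ idm
      ⊠-∘ˡ = E.trans (E.sym M.⊗-∘) (M.⊗-resp-≈ E.refl identityˡ)

      ⊠-∘ʳ : ∀ {A B B′ B″} {f : B ⇒ B′} {g : B′ ⇒ B″} → (idm {A} ⊠₁ g) ⊙ (idm ⊠₁ f) ≈ idm ⊠₁ (g ⊙ f)
      ⊠-∘ʳ = E.trans (E.sym M.⊗-∘) (M.⊗-resp-≈ identityˡ E.refl)

      ⊠-swap : ∀ {A A′ B B′} {f : A ⇒ A′} {g : B ⇒ B′} →
               (f ⊠₁ idm) ⊙ (idm ⊠₁ g) ≈ (idm ⊠₁ g) ⊙ (f ⊠₁ idm)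
      ⊠-swap = E.trans (E.sym M.⊗-∘) (E.trans
        (M.⊗-resp-≈ (E.trans identityʳ (E.sym identityˡ)) (E.trans identityˡ (E.sym identityʳ))) M.⊗-∘)

      L : ∀ {A B D} → ((A ⊗₀ B) ⊗₀ D) ⇒ ((A ⊠₀ B) ⊠₀ D)
      L = (θ ⊠₁ idm) ⊙ θ

      R : ∀ {A B D} → (A ⊗₀ (B ⊗₀ D)) ⇒ (A ⊠₀ (B ⊠₀ D))
      R = (idm ⊠₁ θ) ⊙ θ

      L⁻ : ∀ {A B D} → ((A ⊠₀ B) ⊠₀ D) ⇒ ((A ⊗₀ B) ⊗₀ D)
      L⁻ = θ⁻ ⊙ (θ⁻ ⊠₁ idm)

      R⁻ : ∀ {A B D} → (A ⊠₀ (B ⊠₀ D)) ⇒ (A ⊗₀ (B ⊗₀ D))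
      R⁻ = θ⁻ ⊙ (idm ⊠₁ θ⁻)

      L-inverse : ∀ {A B D} → IsInverse (L {A} {B} {D}) L⁻
      L-inverse = ∘-inverse (⊠-inverse θ-inverse id-inverse) θ-inverse

      R-inverse : ∀ {A B D} → IsInverse (R {A} {B} {D}) R⁻
      R-inverse = ∘-inverse (⊠-inverse id-inverse θ-inverse) θ-inverse

      α : ∀ {A B D} → ((A ⊗₀ B) ⊗₀ D) ⇒ (A ⊗₀ (B ⊗₀ D))
      α = R⁻ ⊙ (M.α⇒ ⊙ L)

      R-α : ∀ {A B D} → R {A} {B} {D} ⊙ α ≈ M.α⇒ ⊙ L
      R-α = cancelˡ (IsInverse.invˡ R-inverse)

      L-natural : ∀ {A A′ B B′ D D′} {f : A ⇒ A′} {g : B ⇒ B′} {h : D ⇒ D′} →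
                  L ⊙ ((f ⊗₁ g) ⊗₁ h) ≈ ((f ⊠₁ g) ⊠₁ h) ⊙ L
      L-natural {f = f} {g} {h} = begin
        ((θ ⊠₁ idm) ⊙ θ) ⊙ ((f ⊗₁ g) ⊗₁ h)   ≈⟨ assoc ⟩
        (θ ⊠₁ idm) ⊙ (θ ⊙ ((f ⊗₁ g) ⊗₁ h))   ≈⟨ refl⟩⊙⟨ θ-natural ⟩
        (θ ⊠₁ idm) ⊙ (((f ⊗₁ g) ⊠₁ h) ⊙ θ)   ≈⟨ extend (E.trans (E.sym M.⊗-∘) (E.trans
          (M.⊗-resp-≈ θ-natural (E.trans identityˡ (E.sym identityʳ))) M.⊗-∘)) ⟩
        ((f ⊠₁ g) ⊠₁ h) ⊙ ((θ ⊠₁ idm) ⊙ θ)   ∎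

      R-natural : ∀ {A A′ B B′ D D′} {f : A ⇒ A′} {g : B ⇒ B′} {h : D ⇒ D′} →
                  R ⊙ (f ⊗₁ (g ⊗₁ h)) ≈ (f ⊠₁ (g ⊠₁ h)) ⊙ R
      R-natural {f = f} {g} {h} = begin
        ((idm ⊠₁ θ) ⊙ θ) ⊙ (f ⊗₁ (g ⊗₁ h))   ≈⟨ assoc ⟩
        (idm ⊠₁ θ) ⊙ (θ ⊙ (f ⊗₁ (g ⊗₁ h)))   ≈⟨ refl⟩⊙⟨ θ-natural ⟩
        (idm ⊠₁ θ) ⊙ ((f ⊠₁ (g ⊗₁ h)) ⊙ θ)   ≈⟨ extend (E.trans (E.sym M.⊗-∘) (E.trans
          (M.⊗-resp-≈ (E.trans identityˡ (E.sym identityʳ)) θ-natural) M.⊗-∘)) ⟩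
        (f ⊠₁ (g ⊠₁ h)) ⊙ ((idm ⊠₁ θ) ⊙ θ)   ∎

      α-natural : ∀ {A A′ B B′ D D′} {f : A ⇒ A′} {g : B ⇒ B′} {h : D ⇒ D′} →
                  α ⊙ ((f ⊗₁ g) ⊗₁ h) ≈ (f ⊗₁ (g ⊗₁ h)) ⊙ α
      α-natural {f = f} {g} {h} = monic R-inverse (begin
        R ⊙ (α ⊙ ((f ⊗₁ g) ⊗₁ h))           ≈⟨ extend R-α ⟩
        M.α⇒ ⊙ (L ⊙ ((f ⊗₁ g) ⊗₁ h))        ≈⟨ refl⟩⊙⟨ L-natural ⟩
        M.α⇒ ⊙ (((f ⊠₁ g) ⊠₁ h) ⊙ L)        ≈⟨ extend M.α-natural ⟩
        (f ⊠₁ (g ⊠₁ h)) ⊙ (M.α⇒ ⊙ L)        ≈⟨ refl⟩⊙⟨ R-α ⟨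
        (f ⊠₁ (g ⊠₁ h)) ⊙ (R ⊙ α)           ≈⟨ extend R-natural ⟨
        R ⊙ ((f ⊗₁ (g ⊗₁ h)) ⊙ α)           ∎)

      triangle : ∀ {A B} → (idm {A} ⊗₁ (M.λ⇒ {B} ⊙ θ)) ⊙ α ≈ (M.ρ⇒ ⊙ θ) ⊗₁ idm
      triangle = monic θ-inverse (begin
        θ ⊙ ((idm ⊗₁ (M.λ⇒ ⊙ θ)) ⊙ α)               ≈⟨ extend θ-natural ⟩
        (idm ⊠₁ (M.λ⇒ ⊙ θ)) ⊙ (θ ⊙ α)               ≈⟨ ⊠-∘ʳ ⟩⊙⟨refl ⟨
        ((idm ⊠₁ M.λ⇒) ⊙ (idm ⊠₁ θ)) ⊙ (θ ⊙ α)      ≈⟨ assoc ⟩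
        (idm ⊠₁ M.λ⇒) ⊙ ((idm ⊠₁ θ) ⊙ (θ ⊙ α))      ≈⟨ refl⟩⊙⟨ assoc ⟨
        (idm ⊠₁ M.λ⇒) ⊙ (R ⊙ α)                     ≈⟨ refl⟩⊙⟨ R-α ⟩
        (idm ⊠₁ M.λ⇒) ⊙ (M.α⇒ ⊙ L)                  ≈⟨ pullˡ M.triangle ⟩
        (M.ρ⇒ ⊠₁ idm) ⊙ ((θ ⊠₁ idm) ⊙ θ)            ≈⟨ pullˡ ⊠-∘ˡ ⟩
        ((M.ρ⇒ ⊙ θ) ⊠₁ idm) ⊙ θ                     ≈⟨ θ-natural ⟨
        θ ⊙ ((M.ρ⇒ ⊙ θ) ⊗₁ idm)                     ∎)

      -- Each arrow α of the pentagon for ⊗ is carried to the one for ⊠ by the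
      -- comparisons of fourfold products.
      Ψ-α-left : ∀ {A B D E} →
        ((R {A} {B} {D} ⊠₁ idm {E}) ⊙ θ) ⊙ (α ⊗₁ idm) ≈ (M.α⇒ ⊠₁ idm) ⊙ ((L ⊠₁ idm) ⊙ θ)
      Ψ-α-left = begin
        ((R ⊠₁ idm) ⊙ θ) ⊙ (α ⊗₁ idm)        ≈⟨ assoc ⟩
        (R ⊠₁ idm) ⊙ (θ ⊙ (α ⊗₁ idm))        ≈⟨ refl⟩⊙⟨ θ-natural ⟩
        (R ⊠₁ idm) ⊙ ((α ⊠₁ idm) ⊙ θ)        ≈⟨ extend (E.trans ⊠-∘ˡ (E.trans
                                                  (M.⊗-resp-≈ R-α E.refl) (E.sym ⊠-∘ˡ))) ⟩
        (M.α⇒ ⊠₁ idm) ⊙ ((L ⊠₁ idm) ⊙ θ)     ∎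

      Ψ-α-right : ∀ {A B D E} →
        ((idm {A} ⊠₁ R {B} {D} {E}) ⊙ θ) ⊙ (idm ⊗₁ α) ≈ (idm ⊠₁ M.α⇒) ⊙ ((idm ⊠₁ L) ⊙ θ)
      Ψ-α-right = begin
        ((idm ⊠₁ R) ⊙ θ) ⊙ (idm ⊗₁ α)        ≈⟨ assoc ⟩
        (idm ⊠₁ R) ⊙ (θ ⊙ (idm ⊗₁ α))        ≈⟨ refl⟩⊙⟨ θ-natural ⟩
        (idm ⊠₁ R) ⊙ ((idm ⊠₁ α) ⊙ θ)        ≈⟨ extend (E.trans ⊠-∘ʳ (E.trans
                                                  (M.⊗-resp-≈ E.refl R-α) (E.sym ⊠-∘ʳ))) ⟩
        (idm ⊠₁ M.α⇒) ⊙ ((idm ⊠₁ L) ⊙ θ)     ∎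

      Ψ-α-middle : ∀ {A B D E} →
        ((idm ⊠₁ L) ⊙ θ) ⊙ α {A} {B ⊗₀ D} {E} ≈ M.α⇒ ⊙ ((R ⊠₁ idm) ⊙ θ)
      Ψ-α-middle = begin
        ((idm ⊠₁ L) ⊙ θ) ⊙ α                                   ≈⟨ (⊠-∘ʳ ⟩⊙⟨refl) ⟩⊙⟨refl ⟨
        (((idm ⊠₁ (θ ⊠₁ idm)) ⊙ (idm ⊠₁ θ)) ⊙ θ) ⊙ α           ≈⟨ assoc ⟩⊙⟨refl ⟩
        ((idm ⊠₁ (θ ⊠₁ idm)) ⊙ R) ⊙ α                          ≈⟨ assoc ⟩
        (idm ⊠₁ (θ ⊠₁ idm)) ⊙ (R ⊙ α)                          ≈⟨ refl⟩⊙⟨ R-α ⟩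
        (idm ⊠₁ (θ ⊠₁ idm)) ⊙ (M.α⇒ ⊙ L)                       ≈⟨ extend M.α-natural ⟨
        M.α⇒ ⊙ (((idm ⊠₁ θ) ⊠₁ idm) ⊙ ((θ ⊠₁ idm) ⊙ θ))        ≈⟨ refl⟩⊙⟨ pullˡ ⊠-∘ˡ ⟩
        M.α⇒ ⊙ ((R ⊠₁ idm) ⊙ θ)                                ∎

      -- Serves the middle vertex of `α ⊙ α`. One order of the two factors has to be fixed;
      -- `Ψ-α-last` meets the other one and exchanges them by `⊠-swap`.
      θ⊠θ : ∀ {A B D E} → ((A ⊗₀ B) ⊠₀ (D ⊗₀ E)) ⇒ ((A ⊠₀ B) ⊠₀ (D ⊠₀ E))
      θ⊠θ = (θ ⊠₁ idm) ⊙ (idm ⊠₁ θ)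

      Ψ-α-first : ∀ {A B D E} →
        (θ⊠θ ⊙ θ) ⊙ α {A ⊗₀ B} {D} {E} ≈ M.α⇒ ⊙ ((L ⊠₁ idm) ⊙ θ)
      Ψ-α-first = begin
        (θ⊠θ ⊙ θ) ⊙ α                                          ≈⟨ assoc ⟩⊙⟨refl ⟩
        ((θ ⊠₁ idm) ⊙ R) ⊙ α                                   ≈⟨ assoc ⟩
        (θ ⊠₁ idm) ⊙ (R ⊙ α)                                   ≈⟨ refl⟩⊙⟨ R-α ⟩
        (θ ⊠₁ idm) ⊙ (M.α⇒ ⊙ L)                                ≈⟨ M.⊗-resp-≈ E.refl M.⊗-id ⟩⊙⟨refl ⟨
        (θ ⊠₁ (idm ⊠₁ idm)) ⊙ (M.α⇒ ⊙ L)                       ≈⟨ extend M.α-natural ⟨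
        M.α⇒ ⊙ (((θ ⊠₁ idm) ⊠₁ idm) ⊙ ((θ ⊠₁ idm) ⊙ θ))        ≈⟨ refl⟩⊙⟨ pullˡ ⊠-∘ˡ ⟩
        M.α⇒ ⊙ ((L ⊠₁ idm) ⊙ θ)                                ∎

      Ψ-α-last : ∀ {A B D E} →
        ((idm ⊠₁ R) ⊙ θ) ⊙ α {A} {B} {D ⊗₀ E} ≈ M.α⇒ ⊙ (θ⊠θ ⊙ θ)
      Ψ-α-last = begin
        ((idm ⊠₁ R) ⊙ θ) ⊙ α                                   ≈⟨ (⊠-∘ʳ ⟩⊙⟨refl) ⟩⊙⟨refl ⟨
        (((idm ⊠₁ (idm ⊠₁ θ)) ⊙ (idm ⊠₁ θ)) ⊙ θ) ⊙ α           ≈⟨ assoc ⟩⊙⟨refl ⟩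
        ((idm ⊠₁ (idm ⊠₁ θ)) ⊙ R) ⊙ α                          ≈⟨ assoc ⟩
        (idm ⊠₁ (idm ⊠₁ θ)) ⊙ (R ⊙ α)                          ≈⟨ refl⟩⊙⟨ R-α ⟩
        (idm ⊠₁ (idm ⊠₁ θ)) ⊙ (M.α⇒ ⊙ L)                       ≈⟨ extend M.α-natural ⟨
        M.α⇒ ⊙ (((idm ⊠₁ idm) ⊠₁ θ) ⊙ ((θ ⊠₁ idm) ⊙ θ))        ≈⟨ refl⟩⊙⟨ (M.⊗-resp-≈ M.⊗-id E.refl ⟩⊙⟨refl) ⟩
        M.α⇒ ⊙ ((idm ⊠₁ θ) ⊙ ((θ ⊠₁ idm) ⊙ θ))                 ≈⟨ refl⟩⊙⟨ pullˡ (E.sym ⊠-swap) ⟩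
        M.α⇒ ⊙ (θ⊠θ ⊙ θ)                                       ∎

      pentagon : ∀ {A B D E} →
        (idm {A} ⊗₁ α {B} {D} {E}) ⊙ (α ⊙ (α ⊗₁ idm)) ≈ α ⊙ α
      pentagon = monic (∘-inverse (⊠-inverse id-inverse R-inverse) θ-inverse) (begin
        Ψ₄ ⊙ ((idm ⊗₁ α) ⊙ (α ⊙ (α ⊗₁ idm)))                   ≈⟨ extend Ψ-α-right ⟩
        (idm ⊠₁ M.α⇒) ⊙ (((idm ⊠₁ L) ⊙ θ) ⊙ (α ⊙ (α ⊗₁ idm)))  ≈⟨ refl⟩⊙⟨ extend Ψ-α-middle ⟩
        (idm ⊠₁ M.α⇒) ⊙ (M.α⇒ ⊙ (((R ⊠₁ idm) ⊙ θ) ⊙ (α ⊗₁ idm)))  ≈⟨ refl⟩⊙⟨ refl⟩⊙⟨ Ψ-α-left ⟩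
        (idm ⊠₁ M.α⇒) ⊙ (M.α⇒ ⊙ ((M.α⇒ ⊠₁ idm) ⊙ Ψ₁))          ≈⟨ refl⟩⊙⟨ assoc ⟨
        (idm ⊠₁ M.α⇒) ⊙ ((M.α⇒ ⊙ (M.α⇒ ⊠₁ idm)) ⊙ Ψ₁)          ≈⟨ pullˡ M.pentagon ⟩
        (M.α⇒ ⊙ M.α⇒) ⊙ Ψ₁                                     ≈⟨ assoc ⟩
        M.α⇒ ⊙ (M.α⇒ ⊙ Ψ₁)                                     ≈⟨ refl⟩⊙⟨ Ψ-α-first ⟨
        M.α⇒ ⊙ ((θ⊠θ ⊙ θ) ⊙ α)                                 ≈⟨ extend Ψ-α-last ⟨
        Ψ₄ ⊙ (α ⊙ α)                                           ∎)
        where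
        Ψ₁ = (L ⊠₁ idm) ⊙ θ
        Ψ₄ = (idm ⊠₁ R) ⊙ θ

    monoidal : MonoidalStructure C _⊗₀_ _⊗₁_ I
    monoidal = record
      { ⊗-resp-≈  = λ p q → monic θ-inverse (E.trans θ-natural
                      (E.trans (M.⊗-resp-≈ p q ⟩⊙⟨refl) (E.sym θ-natural)))
      ; ⊗-id      = monic θ-inverse (E.trans θ-natural
                      (E.trans (M.⊗-id ⟩⊙⟨refl) (E.trans identityˡ (E.sym identityʳ))))
      ; ⊗-∘       = monic θ-inverse (E.trans θ-natural (E.trans (M.⊗-∘ ⟩⊙⟨refl) (E.trans assoc
                      (E.trans (refl⟩⊙⟨ E.sym θ-natural) (extend (E.sym θ-natural))))))
      ; λ⇒        = M.λ⇒ ⊙ θ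
      ; λ⇐        = θ⁻ ⊙ M.λ⇐
      ; ρ⇒        = M.ρ⇒ ⊙ θ
      ; ρ⇐        = θ⁻ ⊙ M.ρ⇐
      ; α⇒        = α
      ; α⇐        = (L⁻ ⊙ M.α⇐) ⊙ R
      ; λ-inverse = ∘-inverse M.λ-inverse θ-inverse
      ; ρ-inverse = ∘-inverse M.ρ-inverse θ-inverse
      ; α-inverse = ∘-inverse (sym-inverse R-inverse) (∘-inverse M.α-inverse L-inverse)
      ; λ-natural = E.trans assoc (E.trans (refl⟩⊙⟨ θ-natural) (extend M.λ-natural))
      ; ρ-natural = E.trans assoc (E.trans (refl⟩⊙⟨ θ-natural) (extend M.ρ-natural))
      ; α-natural = α-natural
      ; triangle  = triangle
      ; pentagon  = pentagon
      }

-- Finite sums in 𝔽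

total : ∀ {A} → (Fin A → ℕ) → ℕ
total {zero}  n = 0
total {suc A} n = n zero + total (n ∘ suc)

encode : ∀ {A} (n : Fin A → ℕ) → Σ (Fin A) (Fin ∘ n) → Fin (total n)
encode n (zero  , i) = i ↑ˡ total (n ∘ suc)
encode n (suc a , i) = n zero ↑ʳ encode (n ∘ suc) (a , i)

decode : ∀ {A} (n : Fin A → ℕ) → Fin (total n) → Σ (Fin A) (Fin ∘ n)
decode {suc A} n p =
  [ (zero ,_) , (λ q → Product.map suc id (decode (n ∘ suc) q)) ]′ (splitAt (n zero) p)

decode-encode : ∀ {A} (n : Fin A → ℕ) s → decode n (encode n s) ≡ s
decode-encode n (zero  , i) rewrite splitAt-↑ˡ (n zero) i (total (n ∘ suc)) = refl
decode-encode n (suc a , i)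
  rewrite splitAt-↑ʳ (n zero) (total (n ∘ suc)) (encode (n ∘ suc) (a , i)) =
  cong (Product.map suc id) (decode-encode (n ∘ suc) (a , i))

encode-decode : ∀ {A} (n : Fin A → ℕ) p → encode n (decode n p) ≡ p
encode-decode {suc A} n p with splitAt (n zero) p | join-splitAt (n zero) (total (n ∘ suc)) p
... | inj₁ i | e = e
... | inj₂ q | e = trans (cong (n zero ↑ʳ_) (encode-decode (n ∘ suc) q)) e

fibre-injective : ∀ {A} {T : Fin A → Set} {a} {s t : T a} →
                  _≡_ {A = Σ (Fin A) T} (a , s) (a , t) → s ≡ t
fibre-injective = ,-injectiveʳ-UIP (Decidable⇒UIP.≡-irrelevant _≟_)

encode-injective : ∀ {A} (n : Fin A → ℕ) {s t} → encode n s ≡ encode n t → s ≡ t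
encode-injective n e =
  trans (sym (decode-encode n _)) (trans (cong (decode n) e) (decode-encode n _))

encode-injectiveʳ : ∀ {A} (n : Fin A → ℕ) {a i j} → encode n (a , i) ≡ encode n (a , j) → i ≡ j
encode-injectiveʳ n e = fibre-injective (encode-injective n e)

record Finite (S : Set) : Set where
  field
    card    : ℕ
    enc     : S → Fin card
    dec     : Fin card → S
    dec-enc : ∀ s → dec (enc s) ≡ s
    enc-dec : ∀ p → enc (dec p) ≡ p

  enc-injective : ∀ {s t} → enc s ≡ enc t → s ≡ t
  enc-injective e = trans (sym (dec-enc _)) (trans (cong dec e) (dec-enc _))

open Finite ⦃ ... ⦄

instance
  Fin-finite : ∀ {n} → Finite (Fin n)
  Fin-finite {n} = record
    { card = n ; enc = id ; dec = id ; dec-enc = λ _ → refl ; enc-dec = λ _ → refl }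

  Σ-finite : ∀ {A} {n : Fin A → ℕ} → Finite (Σ (Fin A) (λ a → Fin (n a)))
  Σ-finite {n = n} = record
    { card    = total n
    ; enc     = encode n
    ; dec     = decode n
    ; dec-enc = decode-encode n
    ; enc-dec = encode-decode n
    }

Pointwise : ∀ {A} {T : Fin A → Set} → (∀ {a} → T a → T a → Set) → (t t′ : ∀ a → T a) → Set
Pointwise R t t′ = ∀ a → R (t a) (t′ a)

private
  consΠ : ∀ {A} {T : Fin (suc A) → Set} → T zero → (∀ a → T (suc a)) → ∀ a → T a
  consΠ x t zero    = x
  consΠ x t (suc a) = t a

-- Finitely many coordinates are changed one at a time; reflexivity of R keeps
-- the other ones fixed.
EqClosure-Π : ∀ {A} {T : Fin A → Set} (R : ∀ {a} → T a → T a → Set) →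
              (∀ {a} (x : T a) → R x x) →
              ∀ {t t′ : ∀ a → T a} → (∀ a → EqClosure R (t a) (t′ a)) →
              EqClosure (Pointwise {T = T} R) t t′
EqClosure-Π {zero}  R R-refl h = EqC.return (λ ())
EqClosure-Π {suc A} {T} R R-refl {t} {t′} h =
  -- Functions need not be extensional, so a reflexive generator joins `t` to the function rebuilt
  -- from its head and tail; the last link does the same for `t′`.
  EqC.transitive _ (EqC.return λ { zero → R-refl _ ; (suc a) → R-refl _ })
  (EqC.transitive _
    (EqC.gmap (consΠ {T = T} (t zero)) (λ r → λ { zero → R-refl _ ; (suc a) → r a })
      (EqClosure-Π R R-refl (λ a → h (suc a))))
  (EqC.transitive _
    (EqC.gmap (λ x → consΠ {T = T} x (t′ ∘ suc)) (λ r → λ { zero → r ; (suc a) → R-refl _ })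
      (h zero))
  (EqC.return λ { zero → R-refl _ ; (suc a) → R-refl _ })))

-- Maps of `Ctx` between enumerated finite types

module FiniteMaps (𝒞 : ContextualSubcategory) where
  open ContextualSubcategory 𝒞
  open Substitution 𝒞

  -- The choice of enumerations is immaterial, since `Ctx` contains every bijection.
  record CtxMap {S T : Set} ⦃ _ : Finite S ⦄ ⦃ _ : Finite T ⦄ (f : S → T) : Set where
    constructor ctxMap
    field
      inCtx : InCtx (enc ∘ f ∘ dec)
  open CtxMap public

  opaque
    CtxMap-resp : ∀ {S T : Set} ⦃ _ : Finite S ⦄ ⦃ _ : Finite T ⦄ {f g : S → T} →
                  f ≗ g → CtxMap f → CtxMap g
    CtxMap-resp e (ctxMap cf) = ctxMap (resp-≗ (λ p → cong enc (e (dec p))) cf)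

    CtxMap-∘ : ∀ {S T U : Set} ⦃ _ : Finite S ⦄ ⦃ _ : Finite T ⦄ ⦃ _ : Finite U ⦄
               {f : S → T} {g : T → U} → CtxMap g → CtxMap f → CtxMap (g ∘ f)
    CtxMap-∘ {f = f} {g} (ctxMap cg) (ctxMap cf) =
      ctxMap (resp-≗ (λ p → cong (enc ∘ g) (dec-enc (f (dec p)))) (∘-closed cg cf))

    -- The hypotheses are the elementwise form of a pullback square: `p` and `q` are jointly
    -- injective, and every compatible pair has a filler.
    CtxMap-pullback :
      ∀ {P X B Y : Set} ⦃ _ : Finite P ⦄ ⦃ _ : Finite X ⦄ ⦃ _ : Finite B ⦄ ⦃ _ : Finite Y ⦄
      {p : P → X} {q : P → B} {f : X → Y} {b : B → Y} →
      f ∘ p ≗ b ∘ q →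
      (∀ {z w} → p z ≡ p w → q z ≡ q w → z ≡ w) →
      (∀ x y → f x ≡ b y → Σ[ z ∈ P ] (p z ≡ x × q z ≡ y)) →
      CtxMap f → CtxMap q
    CtxMap-pullback {P} {X} {B} {Y} {p = p} {q} {f} {b} comm inj fill (ctxMap cf) =
      ctxMap (pullback-stable {p = enc ∘ p ∘ dec} {b = enc ∘ b ∘ dec} (record
      { commutes  = λ z → cong enc (trans (cong f (dec-enc _))
                            (trans (comm (dec z)) (cong b (sym (dec-enc _)))))
      ; universal = λ u v e →
          let w = λ k → fill (dec (u k)) (dec (v k)) (enc-injective (e k)) in
            (λ k → enc (proj₁ (w k)))
          , (λ k → trans (cong (enc ∘ p) (dec-enc _))
                     (trans (cong enc (proj₁ (proj₂ (w k)))) (enc-dec {S = X} _)))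
          , (λ k → trans (cong (enc ∘ q) (dec-enc _))
                     (trans (cong enc (proj₂ (proj₂ (w k)))) (enc-dec {S = B} _)))
      ; unique    = λ w w′ e e′ k → trans (sym (enc-dec {S = P} _))
          (trans (cong enc (inj (enc-injective (e k)) (enc-injective (e′ k)))) (enc-dec {S = P} _))
      }) cf)

    -- With `f` as both projections, `S` is a pullback of the identity of `T` along itself.
    CtxMap-bijection : ∀ {S T : Set} ⦃ _ : Finite S ⦄ ⦃ _ : Finite T ⦄ {f : S → T} →
      (∀ {s t} → f s ≡ f t → s ≡ t) → (∀ y → Σ[ z ∈ S ] f z ≡ y) → CtxMap f
    CtxMap-bijection {T = T} {f = f} inj surj =
      CtxMap-pullback {p = f} {q = f} {f = id} {b = id} (λ _ → refl) (λ e _ → inj e)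
        (λ { x .x refl → let (z , e) = surj x in z , e , e })
        (ctxMap (resp-≗ (λ p → sym (enc-dec {S = T} p)) id-closed))

    total-map : ∀ {A} {n n′ : Fin A → ℕ} (j : ∀ a → Fin (n a) → Fin (n′ a)) →
                Fin (total n) → Fin (total n′)
    total-map j p = encode _ (Product.map₂ (λ {a} → j a) (decode _ p))

    -- Closure under `+` is binary, whence the induction on the number of summands; the empty sum
    -- gives the identity of `Fin 0`.
    total-map-closed : ∀ {A} {n n′ : Fin A → ℕ} {j : ∀ a → Fin (n a) → Fin (n′ a)} →
                       (∀ a → InCtx (j a)) → InCtx (total-map {n = n} {n′} j)
    total-map-closed {zero}  c = resp-≗ (λ ()) id-closed
    total-map-closed {suc A} {n} {n′} {j} c =
      resp-≗ e (+-closed (c zero) (total-map-closed (c ∘ suc)))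
      where
      e : j zero ⊕ total-map (λ a → j (suc a)) ≗ total-map j
      e p with splitAt (n zero) p
      ... | inj₁ i = refl
      ... | inj₂ q = refl

    -- The map is the pullback of `f` along the projection of the sum to its index set.
    reindex-closed : ∀ {A A′} {n : Fin A′ → ℕ} {f : Fin A → Fin A′} → InCtx f →
      CtxMap {S = Σ (Fin A) (Fin ∘ n ∘ f)} {T = Σ (Fin A′) (Fin ∘ n)} (λ (a , i) → f a , i)
    reindex-closed {f = f} cf = CtxMap-pullback {p = proj₁} {b = proj₁} (λ _ → refl)
      (λ { {a , i} {.a , k} refl e → cong (a ,_) (fibre-injective e) })
      (λ { a (b , i) refl → (a , i) , refl , refl }) (ctxMap cf)

    -- Factor through the sum of the `n′ (f a)` over `A`: a fibrewise map, handled by closure under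
    -- `+`, followed by a reindexing, handled by pullback stability.
    CtxMap-Σ : ∀ {A A′} {n : Fin A → ℕ} {n′ : Fin A′ → ℕ} {f : Fin A → Fin A′}
               {j : ∀ a → Fin (n a) → Fin (n′ (f a))} →
               InCtx f → (∀ a → InCtx (j a)) →
               CtxMap {S = Σ (Fin A) (Fin ∘ n)} {T = Σ (Fin A′) (Fin ∘ n′)}
                      (λ (a , i) → f a , j a i)
    CtxMap-Σ {n = n} {n′} {f} {j} cf cj =
      CtxMap-∘ (reindex-closed {n = n′} cf) (ctxMap (total-map-closed cj))

  module Reassociate {A : ℕ} (n : Fin A → ℕ) (k : Σ (Fin A) (Fin ∘ n) → ℕ) where

    assoc : Σ (Fin (total n)) (λ p → Fin (k (decode n p))) →
            Σ (Fin A) (λ a → Fin (total (λ i → k (a , i))))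
    assoc (p , j) = let (a , i) = decode n p in a , encode (λ i → k (a , i)) (i , j)

    private
      assoc-decode : ∀ p j → let (a , q) = assoc (p , j) in
        _≡_ {A = Σ (Fin A) (Fin ∘ n)} (a , proj₁ (decode (λ i → k (a , i)) q)) (decode n p)
      assoc-decode p j = let (a , i) = decode n p in
        cong (λ s → a , proj₁ s) (decode-encode (λ i → k (a , i)) (i , j))

      assoc-injective : ∀ {s t} → assoc s ≡ assoc t → s ≡ t
      assoc-injective {p , j} {p′ , j′} e = same-p p≡p′ e
        where
        p≡p′ : p ≡ p′
        p≡p′ = trans (sym (encode-decode n p)) (trans (cong (encode n)
          (trans (sym (assoc-decode p j)) (trans (cong (λ (a , q) →
            a , proj₁ (decode (λ i → k (a , i)) q)) e) (assoc-decode p′ j′)))) (encode-decode n p′))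

        -- Only after `p` and `p′` are identified do `j` and `j′` have the same type, so that
        -- injectivity of `encode` can compare them.
        same-p : p ≡ p′ → assoc (p , j) ≡ assoc (p′ , j′) → (p , j) ≡ (p′ , j′)
        same-p refl e = let a = proj₁ (decode n p) in
          cong (p ,_) (fibre-injective (encode-injective (λ i → k (a , i)) (fibre-injective e)))

      assoc-surjective : ∀ t → Σ[ s ∈ _ ] assoc s ≡ t
      assoc-surjective (a , q) = let (s , e) = at (a , proj₁ r) (proj₂ r) _ (decode-encode n _) in
          s , trans e (cong (a ,_) (encode-decode (λ i → k (a , i)) q))
        where
        r = decode (λ i → k (a , i)) q

        -- Generalising over `p` lets the equation be matched, so `j` is never transported along
        -- `decode-encode`.
        at : ∀ t (j : Fin (k t)) p → decode n p ≡ t →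
             Σ[ s ∈ _ ] assoc s ≡ (proj₁ t , encode (λ i → k (proj₁ t , i)) (proj₂ t , j))
        at _ j p refl = (p , j) , refl

    opaque
      assoc-closed : CtxMap assoc
      assoc-closed = CtxMap-bijection assoc-injective assoc-surjective

-- The family tensor

module Families (𝒞 : ContextualSubcategory) where
  open ContextualSubcategory 𝒞
  open Substitution 𝒞
  open FiniteMaps 𝒞
  open Presheaf
  open Nat

  private
    PS = Presheaf Ctx
    _⇛_ = Nat Ctx

  hom-total : ∀ {A A′} {n : Fin A → ℕ} {n′ : Fin A′ → ℕ} (f : Hom A A′)
              (j : ∀ a → Hom (n a) (n′ (fun f a))) → Hom (total n) (total n′)
  hom-total {n = n} {n′} f j =
    (λ p → let (a , i) = decode n p in encode n′ (fun f a , fun (j a) i)) ,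
    inCtx (CtxMap-Σ (mem f) (λ a → mem (j a)))

  record Cell (Y : PS) (C : ℕ) : Set where
    constructor cell
    field
      size  : ℕ
      leaf  : Fin size → Fin C
      label : El Y size
  open Cell public

  record CellStep {Y : PS} {C : ℕ} (c d : Cell Y C) : Set where
    field
      map      : Hom (size c) (size d)
      leaf-eq  : ∀ i → leaf c i ≡ leaf d (fun map i)
      label-eq : Eq Y (size d) (act Y map (label c)) (label d)
  open CellStep public

  leaves : ∀ {Y C A} (c : Fin A → Cell Y C) → Σ (Fin A) (λ a → Fin (size (c a))) → Fin C
  leaves c (a , i) = leaf (c a) i

  -- A representative of the substitution tensor whose finite set over `arity` is a family;
  -- `leaves cells` takes the place of `head`.
  record Tree (X Y : PS) (C : ℕ) : Set where
    constructor tree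
    field
      {arity} : ℕ
      root    : El X arity
      cells   : Fin arity → Cell Y C
      closed  : CtxMap (leaves cells)
  open Tree public

  -- The composite of a generator of A ◁ Y (the cells) with one of the coend over A
  -- (the base); both coends are quotiented at once.
  record TreeStep {X Y : PS} {C : ℕ} (u v : Tree X Y C) : Set where
    field
      base     : Hom (arity u) (arity v)
      root-eq  : Eq X (arity v) (act X base (root u)) (root v)
      cells-eq : ∀ a → CellStep (cells u a) (cells v (fun base a))
  open TreeStep public

  step-refl : ∀ {Y C} (c : Cell Y C) → CellStep c c
  step-refl {Y} c = record { map = idᶜ ; leaf-eq = λ _ → refl ; label-eq = act-id Y }

  same-base : ∀ {X Y C A} {x x′ : El X A} {c c′ : Fin A → Cell Y C} {m m′} →
              Eq X A x x′ → (∀ a → CellStep (c a) (c′ a)) →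
              TreeStep {X} {Y} (tree x c m) (tree x′ c′ m′)
  same-base {X} e s = record
    { base = idᶜ ; root-eq = Eqv.trans X (act-id X) e ; cells-eq = s }

  same-leaves : ∀ {X Y C A} {x : El X A} {n : Fin A → ℕ} {l l′ : ∀ a → Fin (n a) → Fin C}
                {t t′ : ∀ a → El Y (n a)} {m m′} →
                (∀ a i → l a i ≡ l′ a i) → (∀ a → Eq Y (n a) (t a) (t′ a)) →
                TreeStep {X} {Y} (tree x (λ a → cell (n a) (l a) (t a)) m)
                                 (tree x (λ a → cell (n a) (l′ a) (t′ a)) m′)
  same-leaves {X} {Y} p q = same-base (Eqv.refl X) λ a → record
    { map = idᶜ ; leaf-eq = p a ; label-eq = Eqv.trans Y (act-id Y) (q a) }

  treestep-refl : ∀ {X Y C} (u : Tree X Y C) → TreeStep u u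
  treestep-refl {X} u = same-base (Eqv.refl X) (λ a → step-refl (cells u a))

  post-cell : ∀ {Y C D} → (Fin C → Fin D) → Cell Y C → Cell Y D
  post-cell f (cell n l y) = cell n (f ∘ l) y

  post-cell-step : ∀ {Y C D} (f : Fin C → Fin D) {c d : Cell Y C} →
                   CellStep c d → CellStep (post-cell f c) (post-cell f d)
  post-cell-step f s = record
    { map = map s ; leaf-eq = λ i → cong f (leaf-eq s i) ; label-eq = label-eq s }

  map-cell : ∀ {Y Y′ C} → Y ⇛ Y′ → Cell Y C → Cell Y′ C
  map-cell ψ (cell n l y) = cell n l (η ψ y)

  map-cell-step : ∀ {Y Y′ C} (ψ : Y ⇛ Y′) {c d : Cell Y C} →
                  CellStep c d → CellStep (map-cell ψ c) (map-cell ψ d)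
  map-cell-step {Y′ = Y′} ψ s = record
    { map = map s ; leaf-eq = leaf-eq s
    ; label-eq = Eqv.trans Y′ (Eqv.sym Y′ (natural ψ _ _)) (η-cong ψ (label-eq s)) }

  post-tree : ∀ {X Y C D} → Hom C D → Tree X Y C → Tree X Y D
  post-tree f (tree x c m) = tree x (post-cell (fun f) ∘ c) (CtxMap-∘ (ctxMap (mem f)) m)

  post-tree-step : ∀ {X Y C D} (f : Hom C D) {u v : Tree X Y C} →
                   TreeStep u v → TreeStep (post-tree f u) (post-tree f v)
  post-tree-step f s = record
    { base = base s ; root-eq = root-eq s
    ; cells-eq = λ a → post-cell-step (fun f) (cells-eq s a) }

  infix 4 _≋_
  _≋_ : ∀ {X Y C} → Tree X Y C → Tree X Y C → Set
  _≋_ {X} {Y} {C} = EqClosure (TreeStep {X} {Y} {C})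

  infixr 7 _◈_
  _◈_ : PS → PS → PS
  X ◈ Y = record
    { ob       = λ C → EqC.setoid (TreeStep {X} {Y} {C})
    ; act      = post-tree
    ; act-cong = λ {_} {_} {f} {g} p q → EqC.transitive TreeStep
        (EqC.return (same-leaves (λ _ _ → p _) (λ _ → Eqv.refl Y)))
        (EqC.gmap (post-tree g) (post-tree-step g) q)
    ; act-id   = EqC.return (same-leaves (λ _ _ → refl) (λ _ → Eqv.refl Y))
    ; act-∘    = EqC.return (same-leaves (λ _ _ → refl) (λ _ → Eqv.refl Y))
    }

  map-tree : ∀ {X X′ Y Y′ C} → X ⇛ X′ → Y ⇛ Y′ → Tree X Y C → Tree X′ Y′ C
  map-tree φ ψ (tree x c m) = tree (η φ x) (map-cell ψ ∘ c) m

  map-tree-step : ∀ {X X′ Y Y′ C} (φ : X ⇛ X′) (ψ : Y ⇛ Y′) {u v : Tree X Y C} →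
                  TreeStep u v → TreeStep (map-tree φ ψ u) (map-tree φ ψ v)
  map-tree-step {X′ = X′} φ ψ s = record
    { base     = base s
    ; root-eq  = Eqv.trans X′ (Eqv.sym X′ (natural φ _ _)) (η-cong φ (root-eq s))
    ; cells-eq = λ a → map-cell-step ψ (cells-eq s a)
    }

  infixr 7 _◈₁_
  _◈₁_ : ∀ {X X′ Y Y′} → X ⇛ X′ → Y ⇛ Y′ → (X ◈ Y) ⇛ (X′ ◈ Y′)
  φ ◈₁ ψ = record
    { η       = map-tree φ ψ
    ; η-cong  = EqC.gmap (map-tree φ ψ) (map-tree-step φ ψ)
    ; natural = λ f u → EqC.return (treestep-refl _)
    }

  -- Unitors of the family tensor

  CtxMap-fibre : ∀ {A C} {n : Fin A → ℕ} {l : Σ (Fin A) (λ a → Fin (n a)) → Fin C} →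
                 CtxMap l → (v : Hom 1 A) → CtxMap (λ i → l (fun v zero , i))
  CtxMap-fibre {n = n} m v =
    -- Up to a bijection the inclusion of this summand is a pullback of `v : 1 → A`; at a point
    -- outside `Ctx` it need not be in `Ctx`.
    CtxMap-∘ m (CtxMap-∘ (CtxMap-Σ {j = λ _ i → i} (mem v) (λ _ → id-closed))
      (CtxMap-bijection {f = λ i → zero , i} fibre-injective λ { (zero , i) → i , refl }))

  leaf-at : ∀ {Y C A} (c : Fin A → Cell Y C) → CtxMap (leaves c) →
            (v : Hom 1 A) → Hom (size (c (fun v zero))) C
  leaf-at c m v = leaf (c (fun v zero)) , inCtx (CtxMap-fibre m v)

  leaf-at-cong : ∀ {X C A} (c : Fin A → Cell X C) (m m′ : CtxMap (leaves c)) {v v′ : Hom 1 A} →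
    v ≈ᶜ v′ → Eq X C (act X (leaf-at c m v) (label (c (fun v zero))))
                     (act X (leaf-at c m′ v′) (label (c (fun v′ zero))))
  leaf-at-cong {X} {C} c m m′ {v} {v′} e = at (e zero) _ _
    where
    at : ∀ {a a′} → a ≡ a′ → (l : InCtx (leaf (c a))) (l′ : InCtx (leaf (c a′))) →
         Eq X C (act X (leaf (c a) , l) (label (c a))) (act X (leaf (c a′) , l′) (label (c a′)))
    at refl _ _ = act-cong X (λ _ → refl) (Eqv.refl X)

  λ-fun : ∀ {X C} → Tree V X C → El X C
  λ-fun {X} (tree v c m) = act X (leaf-at c m v) (label (c (fun v zero)))

  λ-step : ∀ {X C} {u v : Tree V X C} → TreeStep u v → Eq X C (λ-fun u) (λ-fun v)
  λ-step {X} {u = u} {v} s = Eqv.trans X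
    (Eqv.sym X (act-comp X {f = map (cells-eq s _)}
                {g = leaf-at (cells v) (closed v) (base s ∘ᶜ root u)}
      (λ i → sym (leaf-eq (cells-eq s _) i))))
    (Eqv.trans X (act-cong X (λ _ → refl) (label-eq (cells-eq s _)))
      (leaf-at-cong (cells v) (closed v) (closed v) {base s ∘ᶜ root u} {root v} (root-eq s)))

  -- Each label selects one leaf of its cell. Membership follows from the factorisation through
  -- pairs: `a` goes to `(a , zero)`, then to the selected leaf, then to its image in `C`.
  hom-root : ∀ {C A} (c : Fin A → Cell V C) → CtxMap (leaves c) → Hom A C
  hom-root c m = (λ a → leaf (c a) (fun (label (c a)) zero)) ,
    inCtx (CtxMap-∘ {g = leaves c} m
      (CtxMap-∘ {g = λ (a , i) → a , fun (label (c a)) i}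
        (CtxMap-Σ id-closed (λ a → mem (label (c a))))
        (CtxMap-bijection {f = λ a → a , zero} (cong proj₁) λ { (a , zero) → a , refl })))

  ρ-fun : ∀ {X C} → Tree X V C → El X C
  ρ-fun {X} (tree x c m) = act X (hom-root c m) x

  ρ-step : ∀ {X C} {u v : Tree X V C} → TreeStep u v → Eq X C (ρ-fun u) (ρ-fun v)
  ρ-step {X} {u = u} {v} s = Eqv.trans X
    (Eqv.sym X (act-comp X {f = base s} {g = hom-root (cells v) (closed v)} λ a →
      sym (trans (leaf-eq (cells-eq s a) _)
                 (cong (leaf (cells v (fun (base s) a))) (label-eq (cells-eq s a) zero)))))
    (act-cong X (λ _ → refl) (root-eq s))

  CtxMap-reindex : ∀ {Y C A A′} {c : Fin A → Cell Y C} → CtxMap (leaves c) →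
                   (f : Hom A′ A) → CtxMap (leaves (c ∘ fun f))
  CtxMap-reindex m f = CtxMap-∘ m (CtxMap-Σ {j = λ _ i → i} (mem f) (λ _ → id-closed))

  -- Typically the common source has reindexed cells: one generator out of it fixes the base, the
  -- other changes only the base.
  span : ∀ {X Y C} {u v w : Tree X Y C} → TreeStep u v → TreeStep u w → v ≋ w
  span s t = EqC.transitive TreeStep (EqC.symmetric TreeStep (EqC.return s)) (EqC.return t)

  act-id′ : ∀ (X : PS) {A} {f : Hom A A} {x} → fun f ≗ id → Eq X A (act X f x) x
  act-id′ X e = Eqv.trans X (act-cong X e (Eqv.refl X)) (act-id X)

  λ⇒ : ∀ X → (V ◈ X) ⇛ X
  λ⇒ X = record
    { η       = λ-fun
    ; η-cong  = EqC.gfold (Setoid.isEquivalence (ob X _)) λ-fun λ-step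
    ; natural = λ f u → Eqv.sym X (act-comp X (λ _ → refl))
    }

  λ⇐ : ∀ X → X ⇛ (V ◈ X)
  λ⇐ X = record
    { η       = λ {C} x → tree idᶜ (λ _ → cell C id x) const-closed
    ; η-cong  = λ p → EqC.return (same-leaves (λ _ _ → refl) (λ _ → p))
    ; natural = λ f x → EqC.symmetric TreeStep (EqC.return (same-base (λ _ → refl) λ _ →
        record { map = f ; leaf-eq = λ _ → refl ; label-eq = Eqv.refl X }))
    }
    where
    const-closed : ∀ {C} → CtxMap {S = Σ (Fin 1) (λ _ → Fin C)} proj₂
    const-closed = CtxMap-bijection (λ { {zero , i} {zero , .i} refl → refl })
                                    (λ i → (zero , i) , refl)

  λ⇒∘λ⇐ : ∀ X {C} (x : El X C) → Eq X C (η (λ⇒ X) (η (λ⇐ X) x)) x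
  λ⇒∘λ⇐ X x = act-id′ X (λ _ → refl)

  λ⇐∘λ⇒ : ∀ X {C} (u : Tree V X C) → η (λ⇐ X) (η (λ⇒ X) u) ≋ u
  λ⇐∘λ⇒ X (tree v c m) = span {u = tree idᶜ (c ∘ fun v) (CtxMap-reindex {c = c} m v)}
    (same-base (λ _ → refl) λ { zero → record
      { map = leaf-at c m v ; leaf-eq = λ _ → refl ; label-eq = Eqv.refl X } })
    (record { base = v ; root-eq = λ _ → refl ; cells-eq = λ a → step-refl (c (fun v a)) })

  ρ⇒ : ∀ X → (X ◈ V) ⇛ X
  ρ⇒ X = record
    { η       = ρ-fun
    ; η-cong  = EqC.gfold (Setoid.isEquivalence (ob X _)) ρ-fun ρ-step
    ; natural = λ f u → Eqv.sym X (act-comp X (λ _ → refl))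
    }

  unit-cell : ∀ {C} → Fin C → Cell V C
  unit-cell c = cell 1 (λ _ → c) idᶜ

  ρ⇐ : ∀ X → X ⇛ (X ◈ V)
  ρ⇐ X = record
    { η       = λ x → tree x unit-cell unit-closed
    ; η-cong  = λ p → EqC.return (same-base p λ c → step-refl (unit-cell c))
    ; natural = λ f x → EqC.symmetric TreeStep (EqC.return
        (record { base = f ; root-eq = Eqv.refl X
                ; cells-eq = λ a → step-refl (unit-cell (fun f a)) }))
    }
    where
    unit-closed : ∀ {C} → CtxMap (leaves (unit-cell {C}))
    unit-closed = CtxMap-bijection (λ { {c , zero} {.c , zero} refl → refl })
                                   (λ c → (c , zero) , refl)

  ρ⇒∘ρ⇐ : ∀ X {C} (x : El X C) → Eq X C (η (ρ⇒ X) (η (ρ⇐ X) x)) x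
  ρ⇒∘ρ⇐ X x = act-id′ X (λ _ → refl)

  ρ⇐∘ρ⇒ : ∀ X {C} (u : Tree X V C) → η (ρ⇐ X) (η (ρ⇒ X) u) ≋ u
  ρ⇐∘ρ⇒ X (tree x c m) = span
    {u = tree x (unit-cell ∘ fun r)
           (CtxMap-reindex {c = unit-cell} (closed (η (ρ⇐ X) (act X r x))) r)}
    (record { base = r ; root-eq = Eqv.refl X ; cells-eq = λ a → step-refl (unit-cell (fun r a)) })
    (same-base (Eqv.refl X) λ a → record
      { map = label (c a) ; leaf-eq = λ { zero → refl } ; label-eq = λ _ → refl })
    where r = hom-root c m

  -- Grafting and the associator

  encode-closed : ∀ {A} (n : Fin A → ℕ) → CtxMap (encode n)
  encode-closed n = CtxMap-bijection
    (encode-injective n) (λ p → decode n p , encode-decode n p)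

  hom-total-encode : ∀ {A A′} {n : Fin A → ℕ} {n′ : Fin A′ → ℕ} (f : Hom A A′)
    (j : ∀ a → Hom (n a) (n′ (fun f a))) a i →
    fun (hom-total {n = n} {n′} f j) (encode n (a , i)) ≡ encode n′ (fun f a , fun (j a) i)
  hom-total-encode {n = n} {n′} f j a i =
    cong (λ (b , k) → encode n′ (fun f b , fun (j b) k)) (decode-encode n (a , i))

  module _ {Y Z B C} (c : Cell Y B) (δ : Fin B → Cell Z C) where

    graft-size : Fin (size c) → ℕ
    graft-size i = size (δ (leaf c i))

    -- All leaves of the label are kept distinct, so it is closed by a bijection; identifications of
    -- leaves are left to the leaf map of `graft`.
    graft-label : Tree Y Z (total graft-size)
    graft-label = tree (label c)
      (λ i → cell (graft-size i) (λ j → encode graft-size (i , j)) (label (δ (leaf c i))))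
      (encode-closed graft-size)

    graft : Cell (Y ◈ Z) C
    graft = cell (total graft-size) (leaves (δ ∘ leaf c) ∘ decode graft-size) graft-label

    graft-leaf : ∀ i j → leaf graft (encode graft-size (i , j)) ≡ leaf (δ (leaf c i)) j
    graft-leaf i j = cong (leaves (δ ∘ leaf c)) (decode-encode graft-size (i , j))

  -- `M` sums the fibre maps from `D` over `map s`. The same data relate the two labels by a single
  -- generator, so no chain arises.
  graft-step : ∀ {Y Z B B′ C} {c : Cell Y B} {c′ : Cell Y B′} (f : Fin B → Fin B′)
    {δ : Fin B → Cell Z C} {δ′ : Fin B′ → Cell Z C} →
    CellStep (post-cell f c) c′ → (∀ b → CellStep (δ b) (δ′ (f b))) →
    CellStep (graft c δ) (graft c′ δ′)
  graft-step {c = c} {c′} f {δ} {δ′} s D = record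
    { map      = M
    ; leaf-eq  = λ q → let (i , j) = decode (graft-size c δ) q in
        trans (leaf-eq (D′ i) j) (sym (graft-leaf c′ δ′ (fun (map s) i) (fun (map (D′ i)) j)))
    ; label-eq = EqC.return record
        { base     = map s
        ; root-eq  = label-eq s
        ; cells-eq = λ i → record
            { map      = map (D′ i)
            ; leaf-eq  = hom-total-encode (map s) (map ∘ D′) i
            ; label-eq = label-eq (D′ i)
            }
        }
    }
    where
    D′ : ∀ i → CellStep (δ (leaf c i)) (δ′ (leaf c′ (fun (map s) i)))
    D′ i = subst (λ b → CellStep (δ (leaf c i)) (δ′ b)) (leaf-eq s i) (D (leaf c i))

    M = hom-total {n = graft-size c δ} {graft-size c′ δ′} (map s) (map ∘ D′)

  module _ {Y Z B C A} (c : Fin A → Cell Y B) (δ : Fin B → Cell Z C) where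

    private
      n : ∀ a → Fin (size (c a)) → ℕ
      n a = graft-size (c a) δ

      graft-injective : ∀ {a a′} (s : Σ _ (Fin ∘ n a)) (s′ : Σ _ (Fin ∘ n a′)) →
        _≡_ {A = Σ (Fin A) (λ a → Fin (size (c a)))} (a , proj₁ s) (a′ , proj₁ s′) →
        _≡_ {A = Σ (Fin B) (λ b → Fin (size (δ b)))}
            (leaf (c a) (proj₁ s) , proj₂ s) (leaf (c a′) (proj₁ s′) , proj₂ s′) →
        _≡_ {A = Σ (Fin A) (λ a → Fin (total (n a)))} (a , encode (n a) s) (a′ , encode (n a′) s′)
      graft-injective {a} (i , j) (.i , j′) refl e =
        cong (λ k → a , encode (n a) (i , k)) (fibre-injective e)

    opaque
      -- A leaf of the graft at `a` is a pair `(i , j)`. Sending it to `(leaf (c a) i , j)` is the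
      -- pullback of `leaves c` along the projection to `B`, and composing with `leaves δ` gives the
      -- leaf map.
      graft-closed : CtxMap (leaves c) → CtxMap (leaves δ) → CtxMap (leaves (λ a → graft (c a) δ))
      graft-closed m m′ = CtxMap-∘ {g = leaves δ} m′ (CtxMap-pullback
        {p = λ (a , q) → a , proj₁ (decode (n a) q)}
        {q = λ (a , q) → let (i , j) = decode (n a) q in leaf (c a) i , j}
        {b = proj₁}
        (λ _ → refl)
        (λ { {a , q} {a′ , q′} e e′ → trans (cong (a ,_) (sym (encode-decode (n a) q)))
          (trans (graft-injective (decode (n a) q) (decode (n a′) q′) e e′)
                 (cong (a′ ,_) (encode-decode (n a′) q′))) })
        (λ { (a , i) (_ , j) refl → (a , encode (n a) (i , j))
          , cong (λ s → a , proj₁ s) (decode-encode (n a) (i , j))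
          , cong (λ s → leaf (c a) (proj₁ s) , proj₂ s) (decode-encode (n a) (i , j)) })
        m)

  α-fun : ∀ {X Y Z C} → Tree (X ◈ Y) Z C → Tree X (Y ◈ Z) C
  α-fun (tree (tree x c m) δ m′) = tree x (λ a → graft (c a) δ) (graft-closed c δ m m′)

  α-step : ∀ {X Y Z C} {U U′ : Tree (X ◈ Y) Z C} (f : Hom (arity U) (arity U′)) →
           TreeStep (post-tree f (root U)) (root U′) →
           (∀ b → CellStep (cells U b) (cells U′ (fun f b))) →
           TreeStep (α-fun U) (α-fun U′)
  α-step {U = U} {U′} f s D = record
    { base = base s ; root-eq = root-eq s
    ; cells-eq = λ a → graft-step
        {c = cells (root U) a} {cells (root U′) (fun (base s) a)} (fun f) {cells U} {cells U′}
        (cells-eq s a) D }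

  from-post : ∀ {X Y C} {u v : Tree X Y C} → TreeStep u v → TreeStep (post-tree idᶜ u) v
  from-post s = record { base = base s ; root-eq = root-eq s ; cells-eq = cells-eq s }

  α-cong-root : ∀ {X Y Z B C} {δ : Fin B → Cell Z C} {m} {u u′ : Tree X Y B} → u ≋ u′ →
                α-fun {X} {Y} {Z} (tree u δ m) ≋ α-fun (tree u′ δ m)
  α-cong-root {X} {Y} {Z} {δ = δ} {m} =
    EqC.gmap {R = TreeStep} {S = TreeStep} (λ u → α-fun (tree u δ m)) step
    where
    step : ∀ {u u′} → TreeStep u u′ → TreeStep (α-fun (tree u δ m)) (α-fun (tree u′ δ m))
    step {u} {u′} t = α-step
      {U = tree u δ m} {tree u′ δ m} idᶜ (from-post t) (λ b → step-refl (δ b))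

  -- The roots are related by a chain, the cells by generators. `V′`, with the pushed-forward root
  -- of `U` and the cells of `U′`, separates the two changes.
  α-cong : ∀ {X Y Z C} {U U′ : Tree (X ◈ Y) Z C} → TreeStep U U′ → α-fun U ≋ α-fun U′
  α-cong {X} {Y} {Z} {C} {U} {U′} s = EqC.transitive TreeStep
    (EqC.return first) (α-cong-root {δ = cells U′} {closed U′} (root-eq s))
    where
    V′ : Tree (X ◈ Y) Z C
    V′ = tree (post-tree (base s) (root U)) (cells U′) (closed U′)

    first : TreeStep (α-fun U) (α-fun V′)
    first = α-step {U = U} {V′} (base s) (treestep-refl (root V′)) (cells-eq s)

  α⇒ : ∀ X Y Z → ((X ◈ Y) ◈ Z) ⇛ (X ◈ (Y ◈ Z))
  α⇒ X Y Z = record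
    { η       = α-fun
    ; η-cong  = EqC.gfold (EqC.isEquivalence TreeStep) α-fun α-cong
    ; natural = λ f U →
        let G = λ a → post-cell (fun f) (graft (cells (root U) a) (cells U)) in
        EqC.return (same-base {c = G} {G} (Eqv.refl X) (λ a → step-refl (G a)))
    }

  -- The inverse associator

  module _ {Y Z C A} (c : Fin A → Cell (Y ◈ Z) C) where

    private
      n : Fin A → ℕ
      n a = arity (label (c a))

      k : Σ (Fin A) (Fin ∘ n) → ℕ
      k (a , i) = size (cells (label (c a)) i)

    flat-cell : Σ (Fin A) (Fin ∘ n) → Cell Z C
    flat-cell (a , i) = post-cell (leaf (c a)) (cells (label (c a)) i)

    flat-root : ∀ {X} → El X A → Tree X Y (total n)
    flat-root x = tree x (λ a → cell (n a) (λ i → encode n (a , i)) (root (label (c a))))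
                         (encode-closed n)

    open Reassociate n k

    opaque
      -- After reassociating, the leaf map applies the leaf map of each label, fibrewise over `A`,
      -- and then `leaves c`. The labels' own `closed` fields put the fibrewise part in `Ctx`.
      flat-closed : CtxMap (leaves c) → CtxMap (leaves (flat-cell ∘ decode n))
      flat-closed m = CtxMap-resp
        (λ (p , j) → let (a , i) = decode n p in
          cong (λ s → leaf (c a) (leaves (cells (label (c a))) s))
               (decode-encode (λ i → k (a , i)) (i , j)))
        (CtxMap-∘ {f = assoc} {g = λ (a , q) →
                    leaf (c a) (leaves (cells (label (c a))) (decode (λ i → k (a , i)) q))}
          (CtxMap-∘ {g = leaves c} m
            (CtxMap-Σ id-closed (λ a → inCtx (closed (label (c a))))))
          assoc-closed)

  α⁻-fun : ∀ {X Y Z C} → Tree X (Y ◈ Z) C → Tree (X ◈ Y) Z C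
  α⁻-fun (tree x c m) = tree (flat-root c x) (flat-cell c ∘ decode _) (flat-closed c m)

  -- A TreeStep whose labels are related by a generator of Y ◈ Z instead of a chain.
  record StrongStep {X Y Z C} (u v : Tree X (Y ◈ Z) C) : Set where
    field
      base     : Hom (arity u) (arity v)
      root-eq  : Eq X (arity v) (act X base (root u)) (root v)
      map      : ∀ a → Hom (size (cells u a)) (size (cells v (fun base a)))
      leaf-eq  : ∀ a i → leaf (cells u a) i ≡ leaf (cells v (fun base a)) (fun (map a) i)
      label-eq : ∀ a → TreeStep (post-tree (map a) (label (cells u a)))
                                (label (cells v (fun base a)))

  α⁻-step : ∀ {X Y Z C} {u v : Tree X (Y ◈ Z) C} → StrongStep u v → TreeStep (α⁻-fun u) (α⁻-fun v)
  α⁻-step {X} {Y} {Z} {u = u} {v} s = record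
    { base     = F
    ; root-eq  = EqC.return record
        { base     = S.base
        ; root-eq  = S.root-eq
        ; cells-eq = λ a → record
            { map      = base (S.label-eq a)
            ; leaf-eq  = hom-total-encode {n = n} {n′} S.base (base ∘ S.label-eq) a
            ; label-eq = root-eq (S.label-eq a)
            }
        }
    ; cells-eq = λ p → let (a , i) = decode n p in
        subst (λ t → CellStep (flat-cell (cells u) (a , i)) (flat-cell (cells v) t))
              (sym (decode-encode n′ _)) (step a i)
    }
    where
    module S = StrongStep s
    n  = λ a → arity (label (cells u a))
    n′ = λ a → arity (label (cells v a))
    F  = hom-total {n = n} {n′} S.base (base ∘ S.label-eq)

    step : ∀ a i → CellStep (flat-cell (cells u) (a , i))
                            (flat-cell (cells v) (fun S.base a , fun (base (S.label-eq a)) i))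
    step a i = record
      { map      = map (cells-eq (S.label-eq a) i)
      ; leaf-eq  = λ j → trans (S.leaf-eq a _)
                     (cong (leaf (cells v (fun S.base a))) (leaf-eq (cells-eq (S.label-eq a) i) j))
      ; label-eq = label-eq (cells-eq (S.label-eq a) i)
      }

  -- The generator is split into pushing labels along the cell maps, changing labels in a fixed
  -- shape, and reindexing along the base. Chains occur only in the middle factor, where
  -- `EqClosure-Π` merges one chain per index into a chain of label families.
  α⁻-cong : ∀ {X Y Z C} {u v : Tree X (Y ◈ Z) C} → TreeStep u v → α⁻-fun u ≋ α⁻-fun v
  α⁻-cong {X} {Y} {Z} {C} {u} {v} s = EqC.transitive TreeStep (EqC.return (α⁻-step vertical))
    (EqC.transitive TreeStep
      (EqC.gmap {R = Pointwise TreeStep} {S = TreeStep} (α⁻-fun ∘ with-labels) (α⁻-step ∘ relabel)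
        (EqClosure-Π TreeStep treestep-refl (λ a → label-eq (cells-eq s a))))
      (EqC.return (α⁻-step cartesian)))
    where
    c : Fin (arity u) → Cell (Y ◈ Z) C
    c a = cells v (fun (base s) a)

    with-labels : (∀ a → Tree Y Z (size (c a))) → Tree X (Y ◈ Z) C
    with-labels t = tree (root u) (λ a → cell (size (c a)) (leaf (c a)) (t a))
                         (CtxMap-reindex {c = cells v} (closed v) (base s))

    vertical : StrongStep u (with-labels λ a → post-tree (map (cells-eq s a)) (label (cells u a)))
    vertical = record
      { base     = idᶜ
      ; root-eq  = act-id X
      ; map      = λ a → map (cells-eq s a)
      ; leaf-eq  = λ a → leaf-eq (cells-eq s a)
      ; label-eq = λ a → treestep-refl _
      }

    relabel : ∀ {t t′} → Pointwise TreeStep t t′ → StrongStep (with-labels t) (with-labels t′)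
    relabel r = record
      { base     = idᶜ
      ; root-eq  = act-id X
      ; map      = λ _ → idᶜ
      ; leaf-eq  = λ _ _ → refl
      ; label-eq = λ a → from-post (r a)
      }

    cartesian : StrongStep (with-labels (λ a → label (c a))) v
    cartesian = record
      { base     = base s
      ; root-eq  = root-eq s
      ; map      = λ _ → idᶜ
      ; leaf-eq  = λ _ _ → refl
      ; label-eq = λ a → from-post (treestep-refl _)
      }

  α⇐ : ∀ X Y Z → (X ◈ (Y ◈ Z)) ⇛ ((X ◈ Y) ◈ Z)
  α⇐ X Y Z = record
    { η       = α⁻-fun
    ; η-cong  = EqC.gfold (EqC.isEquivalence TreeStep) α⁻-fun α⁻-cong
    ; natural = λ f u → EqC.return (same-base
        {c = post-cell (fun f) ∘ flat-cell (cells u) ∘ decode _}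
        {post-cell (fun f) ∘ flat-cell (cells u) ∘ decode _}
        (Eqv.refl (X ◈ Y)) λ p → step-refl _)
    }

  -- Flattening forgets the leaf set of `c a`, and grafting puts the sum of the leaves of its label
  -- instead. The comparison `J a` is the label's leaf map; `E` corrects for `decode` after
  -- `encode`.
  α⇒∘α⇐ : ∀ {X Y Z C} (u : Tree X (Y ◈ Z) C) → TreeStep (α-fun (α⁻-fun u)) u
  α⇒∘α⇐ {X} {Y} {Z} (tree x c m) = same-base (Eqv.refl X) λ a → record
    { map      = J a
    ; leaf-eq  = λ t → let (i , r) = decode _ t in trans (leaf-eq (E a i) r)
        (cong (leaf (c a)) (sym (cong (leaves (t′ a)) (decode-encode (k a) (i , fun (map (E a i)) r)))))
    ; label-eq = EqC.return (same-base (Eqv.refl Y) λ i → record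
        { map      = map (E a i)
        ; leaf-eq  = λ r → trans
            (cong (leaves (t′ a) ∘ decode (k a)) (hom-total-encode {n′ = k a} idᶜ (map ∘ E a) i r))
            (cong (leaves (t′ a)) (decode-encode (k a) (i , fun (map (E a i)) r)))
        ; label-eq = label-eq (E a i)
        })
    }
    where
    n = λ a → arity (label (c a))

    t′ : ∀ a → Fin (n a) → Cell Z (size (c a))
    t′ a = cells (label (c a))

    k : ∀ a → Fin (n a) → ℕ
    k a i = size (t′ a i)

    E : ∀ a i → CellStep (flat-cell c (decode n (encode n (a , i)))) (flat-cell c (a , i))
    E a i = subst (λ s → CellStep (flat-cell c (decode n (encode n (a , i)))) (flat-cell c s))
                  (decode-encode n (a , i)) (step-refl _)

    J : ∀ a → Hom _ (size (c a))
    J a = (leaves (t′ a) ∘ decode (k a) , inCtx (closed (label (c a))))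
          ∘ᶜ hom-total {n′ = k a} idᶜ (map ∘ E a)

  -- Grafting copies the cells `δ` along the leaves of `c`, so the way back is indexed by those
  -- leaves; the base `leaves c` sends each copy to its original.
  α⇐∘α⇒ : ∀ {X Y Z C} (U : Tree (X ◈ Y) Z C) → TreeStep (α⁻-fun (α-fun U)) U
  α⇐∘α⇒ {X} {Y} {Z} (tree (tree x c m) δ m′) = record
    { base     = leaves c ∘ decode (size ∘ c) , inCtx m
    ; root-eq  = EqC.return (same-leaves
        (λ a i → cong (leaves c) (decode-encode (size ∘ c) (a , i))) (λ _ → Eqv.refl Y))
    ; cells-eq = λ p → let (a , i) = decode (size ∘ c) p in record
        { map = idᶜ ; leaf-eq = graft-leaf (c a) δ i ; label-eq = act-id Z }
    }

  -- The core of the pentagon. Both sides sum the same cells of `ε`, once over the pairs `(i , j)`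
  -- and once iteratively, so `assoc` compares them. `E`, `M` and `assoc-cast` absorb `decode` after
  -- `encode`, an identity only up to a proof.
  graft-assoc : ∀ {Y Z W B C D} (c : Cell Y B) (δ : Fin B → Cell Z C) (ε : Fin C → Cell W D) →
    CellStep (map-cell (α⇒ Y Z W) (graft (graft c δ) ε)) (graft c (λ b → graft (δ b) ε))
  graft-assoc {Y} {Z} {W} c δ ε = record
    { map      = J
    ; leaf-eq  = λ p → let (q , r) = decode N p ; (i , j) = decode n q in sym (trans
        (graft-leaf c (λ b → graft (δ b) ε) i (encode (k i) (j , r)))
        (graft-leaf (δ (leaf c i)) ε j r))
    ; label-eq = EqC.return (same-base (Eqv.refl Y) λ i → record
        { map      = M i
        ; leaf-eq  = λ t → let (j , r) = decode _ t in trans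
            (cong (encode K ∘ assoc) (decode-encode N (encode n (i , j) , r)))
            (cong (encode K) (assoc-cast _ (decode-encode n (i , j)) r))
        ; label-eq = EqC.return (same-base (Eqv.refl Z) λ j → record
            { map      = map (E i j)
            ; leaf-eq  = hom-total-encode {n′ = k i} idᶜ (map ∘ E i) j
            ; label-eq = label-eq (E i j)
            })
        })
    }
    where
    g = graft c δ
    n = graft-size c δ
    N = graft-size g ε
    K = graft-size c (λ b → graft (δ b) ε)

    k : ∀ i → Fin (n i) → ℕ
    k i = graft-size (δ (leaf c i)) ε

    open Reassociate n (λ (i , j) → k i j)

    J : Hom (total N) (total K)
    J = encode K ∘ assoc ∘ decode N , inCtx assoc-closed

    ε′ : Σ _ (Fin ∘ n) → Cell W _
    ε′ s = ε (leaves (δ ∘ leaf c) s)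

    cast : ∀ {s s′} → s ≡ s′ → CellStep (ε′ s) (ε′ s′)
    cast {s} e = subst (λ s′ → CellStep (ε′ s) (ε′ s′)) e (step-refl (ε′ s))

    E : ∀ i j → CellStep (ε′ (decode n (encode n (i , j)))) (ε′ (i , j))
    E i j = cast (decode-encode n (i , j))

    M : ∀ i → Hom (total (λ j → N (encode n (i , j)))) (total (k i))
    M i = hom-total {n′ = k i} idᶜ (map ∘ E i)

    assoc-cast : ∀ q {s} (e : decode n q ≡ s) r →
      assoc (q , r) ≡ (proj₁ s , encode (k (proj₁ s)) (proj₂ s , fun (map (cast e)) r))
    assoc-cast q refl r = refl

  ◈-monoidal : MonoidalStructure [Ctx,Set] _◈_ _◈₁_ V
  ◈-monoidal = record
    { ⊗-resp-≈ = λ {_} {_} {_} {_} {f} {f′} {g} {g′} p q C u →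
        EqC.return (map-tree-cong {φ = f} {f′} {g} {g′} p q u)
    ; ⊗-id      = λ {X} {Y} C u → EqC.return (treestep-refl u)
    ; ⊗-∘       = λ C u → EqC.return (treestep-refl _)
    ; λ⇒ = λ⇒ _ ; λ⇐ = λ⇐ _ ; ρ⇒ = ρ⇒ _ ; ρ⇐ = ρ⇐ _ ; α⇒ = α⇒ _ _ _ ; α⇐ = α⇐ _ _ _
    ; λ-inverse = λ {X} → record { invˡ = λ C → λ⇒∘λ⇐ X ; invʳ = λ C → λ⇐∘λ⇒ X }
    ; ρ-inverse = λ {X} → record { invˡ = λ C → ρ⇒∘ρ⇐ X ; invʳ = λ C → ρ⇐∘ρ⇒ X }
    ; α-inverse = record
        { invˡ = λ C u → EqC.return (α⇒∘α⇐ u) ; invʳ = λ C U → EqC.return (α⇐∘α⇒ U) }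
    ; λ-natural = λ {X} {X′} {f} C u → Eqv.sym X′ (natural f _ _)
    ; ρ-natural = λ {X} {X′} {f} C u → Eqv.sym X′ (natural f _ _)
    ; α-natural = λ {_} {X′} {_} {_} {_} {_} {f} {g} {h} C U →
        let G = λ a → map-cell (g ◈₁ h) (graft (cells (root U) a) (cells U)) in
        EqC.return (same-base {c = G} {G} (Eqv.refl X′) (λ a → step-refl (G a)))
    ; triangle  = triangle
    ; pentagon  = λ {X} C U → EqC.return (same-base (Eqv.refl X) λ a →
        graft-assoc (cells (root (root U)) a) (cells (root U)) (cells U))
    }
    where
    map-tree-cong : ∀ {X X′ Y Y′ C} {φ φ′ : X ⇛ X′} {ψ ψ′ : Y ⇛ Y′} →
                   (∀ A x → Eq X′ A (η φ x) (η φ′ x)) → (∀ A x → Eq Y′ A (η ψ x) (η ψ′ x)) →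
                   (u : Tree X Y C) → TreeStep (map-tree φ ψ u) (map-tree φ′ ψ′ u)
    map-tree-cong {Y′ = Y′} p q u = same-base (p _ _) λ a → record
      { map = idᶜ ; leaf-eq = λ _ → refl ; label-eq = Eqv.trans Y′ (act-id Y′) (q _ _) }

    triangle : ∀ {X Y} C (U : Tree (X ◈ V) Y C) →
               map-tree (idⁿ Ctx) (λ⇒ Y) (α-fun U) ≋ map-tree (ρ⇒ X) (idⁿ Ctx) U
    triangle {X} {Y} C (tree (tree x c m) δ m′) = span
      {u = tree x (δ ∘ fun r) (CtxMap-reindex {c = δ} m′ r)}
      (same-base (Eqv.refl X) λ a → record
        { map      = leaf-at (cells (graft-label (c a) δ)) (closed (graft-label (c a) δ)) (label (c a))
        ; leaf-eq  = λ j → sym (graft-leaf (c a) δ (fun (label (c a)) zero) j)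
        ; label-eq = Eqv.refl Y
        })
      (record { base = r ; root-eq = Eqv.refl X ; cells-eq = λ a → step-refl (δ (fun r a)) })
      where r = hom-root c m

-- Comparison of ◇ with the family tensor

module Comparison (𝒞 : ContextualSubcategory) where
  open ContextualSubcategory 𝒞
  open Substitution 𝒞
  open FiniteMaps 𝒞
  open Families 𝒞
  open Presheaf
  open Nat

  private
    PS = Presheaf Ctx
    _⇛_ = Nat Ctx

  opaque
    -- The fibres of `b` partition `Fin B`, so this is a bijection.
    incl-closed : ∀ {A B} (b : Fin B → Fin A) →
      CtxMap {S = Σ (Fin A) (λ a → Fin (b ⁻¹ a))} (λ (a , i) → Fibre.incl b a i)
    incl-closed b = CtxMap-bijection
      (λ { {a , i} {a′ , i′} e → same a a′ i i′ (trans (sym (Fibre.incl-holds b a i))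
             (trans (cong b e) (Fibre.incl-holds b a′ i′))) e })
      (λ x → (b x , Fibre.code b (b x) x refl) , Fibre.incl-code b (b x) x refl)
      where
      same : ∀ a a′ (i : Fin (b ⁻¹ a)) (i′ : Fin (b ⁻¹ a′)) → a ≡ a′ →
             Fibre.incl b a i ≡ Fibre.incl b a′ i′ →
             _≡_ {A = Σ (Fin _) (λ a → Fin (b ⁻¹ a))} (a , i) (a′ , i′)
      same a .a i i′ refl e = cong (a ,_) (Fibre.incl-injective b a e)

  rep-cell : ∀ {A Y C} → Rep A Y C → Fin A → Cell Y C
  rep-cell γ a = cell (proj γ ⁻¹ a) (fun (head γ) ∘ Fibre.incl (proj γ) a) (terms γ a)

  tens-tree : ∀ {X Y C} → Tens X Y C → Tree X Y C
  tens-tree ⟦ x , γ ⟧ =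
    tree x (rep-cell γ) (CtxMap-∘ (ctxMap (mem (head γ))) (incl-closed (proj γ)))

  tens-tree-sub : ∀ {X Y C A} {x : El X A} {γ γ′ : Rep A Y C} → Step γ γ′ →
                  TreeStep {X} {Y} (tens-tree ⟦ x , γ ⟧) (tens-tree ⟦ x , γ′ ⟧)
  tens-tree-sub {X} {γ = γ} {γ′} s = same-base (Eqv.refl X) λ a → record
    { map      = restrict S.j S.over a
    ; leaf-eq  = λ i → trans (S.head-eq _)
        (cong (fun (head γ′)) (sym (incl-restrict S.j S.over a i)))
    ; label-eq = S.terms-eq a
    }
    where module S = Step s

  -- The terms of `γ · f` live on fibres of an enumerated pullback. The intermediate tree keeps the
  -- fibres of `proj γ` at the points `f a`, and `reindex` compares the two.
  tens-tree-pull : ∀ {X Y C A A′} (f : Hom A′ A) {x : El X A′} {x′ : El X A} (γ : Rep A Y C) →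
                   Eq X A (act X f x) x′ →
                   tens-tree {X} {Y} ⟦ x , γ · f ⟧ ≋ tens-tree ⟦ x′ , γ ⟧
  tens-tree-pull {X} {Y} f {x} γ e = span
    {u = tree x (rep-cell γ ∘ fun f)
           (CtxMap-reindex {c = rep-cell γ} (closed (tens-tree {X} ⟦ act X f x , γ ⟧)) f)}
    (same-base (Eqv.refl X) λ a → record
      { map      = reindex (fun f) (proj γ) a
      ; leaf-eq  = λ i → cong (fun (head γ)) (sym (π₂-reindex (fun f) (proj γ) a i))
      ; label-eq = Eqv.refl Y
      })
    (record { base = f ; root-eq = e ; cells-eq = λ a → step-refl (rep-cell γ (fun f a)) })

  tens-tree-cong : ∀ {X Y C} {u v : Tens X Y C} → TensStep u v → tens-tree u ≋ tens-tree v
  tens-tree-cong {X} {Y} {u = u} {v} s = EqC.transitive TreeStep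
    (EqC.gmap {R = Step} {S = TreeStep} (λ γ → tens-tree {X} {Y} ⟦ elt u , γ ⟧)
      (λ {γ} {γ′} → tens-tree-sub {γ = γ} {γ′}) (TensStep.sub-eq s))
    (tens-tree-pull {X} {Y} (TensStep.j s) (sub v) (TensStep.elt-eq s))

  θ⇒ : ∀ X Y → (X ◇ Y) ⇛ (X ◈ Y)
  θ⇒ X Y = record
    { η       = tens-tree
    ; η-cong  = EqC.gfold (EqC.isEquivalence TreeStep) tens-tree tens-tree-cong
    ; natural = λ f u → EqC.return (same-base (Eqv.refl X) λ a → step-refl _)
    }

  -- From families back to finite sets over `A`

  module _ {A : ℕ} (n : Fin A → ℕ) where

    index : Fin (total n) → Fin A
    index = proj₁ ∘ decode n

    private
      index-encode : ∀ s → index (encode n s) ≡ proj₁ s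
      index-encode s = cong proj₁ (decode-encode n s)

    at-index : ∀ {a} p → a ≡ index p → Σ[ i ∈ Fin (n a) ] encode n (a , i) ≡ p
    at-index p refl = proj₂ (decode n p) , encode-decode n p

    fibre-fun : ∀ a → Fin (n a) → Fin (index ⁻¹ a)
    fibre-fun a i = Fibre.code index a (encode n (a , i)) (index-encode (a , i))

    incl-fibre : ∀ a i → Fibre.incl index a (fibre-fun a i) ≡ encode n (a , i)
    incl-fibre a i = Fibre.incl-code index a _ _

    opaque
      fibre-closed : ∀ a → CtxMap (fibre-fun a)
      fibre-closed a = CtxMap-bijection
        (λ {i} {i′} e → encode-injectiveʳ n (trans (sym (incl-fibre a i))
          (trans (cong (Fibre.incl index a) e) (incl-fibre a i′))))
        (λ k → let (i , e) = at-index _ (sym (Fibre.incl-holds index a k)) in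
          i , Fibre.incl-injective index a (trans (incl-fibre a i) e))

    hom-fibre : ∀ a → Hom (n a) (index ⁻¹ a)
    hom-fibre a = fibre-fun a , inCtx (fibre-closed a)

    module _ {A′ : ℕ} (f : Fin A′ → Fin A) where
      private
        module Q = Pullback f index

      -- The bijection expressing that a sum pulled back along `f` is the sum of the reindexed
      -- family.
      pull-fun : Σ (Fin A′) (Fin ∘ n ∘ f) → Fin Q.apex
      pull-fun (a , i) = Q.pair a (encode n (f a , i)) (sym (index-encode (f a , i)))

      π₁-pull : ∀ s → Q.π₁ (pull-fun s) ≡ proj₁ s
      π₁-pull s = Q.π₁-pair _ _ _

      π₂-pull : ∀ s → Q.π₂ (pull-fun s) ≡ encode n (f (proj₁ s) , proj₂ s)
      π₂-pull s = Q.π₂-pair _ _ _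

      opaque
        pull-closed : CtxMap pull-fun
        pull-closed = CtxMap-bijection
          (λ {s} {t} e → same s t (trans (sym (π₁-pull s)) (trans (cong Q.π₁ e) (π₁-pull t)))
            (trans (sym (π₂-pull s)) (trans (cong Q.π₂ e) (π₂-pull t))))
          (λ z → let (i , e) = at-index (Q.π₂ z) (Q.square z) in
            (Q.π₁ z , i) , Q.π-injective (π₁-pull (Q.π₁ z , i)) (trans (π₂-pull (Q.π₁ z , i)) e))
          where
          same : ∀ s t → proj₁ s ≡ proj₁ t →
                 encode n (f (proj₁ s) , proj₂ s) ≡ encode n (f (proj₁ t) , proj₂ t) → s ≡ t
          same (a , i) (.a , i′) refl e = cong (a ,_) (encode-injectiveʳ n e)

  tree-rep : ∀ {Y C A} (c : Fin A → Cell Y C) → CtxMap (leaves c) → Rep A Y C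
  tree-rep {Y} c m =
    ⟪ index n , (leaves c ∘ decode n , inCtx m) , (λ a → act Y (hom-fibre n a) (label (c a))) ⟫
    where n = size ∘ c

  tree-tens : ∀ {X Y C} → Tree X Y C → Tens X Y C
  tree-tens (tree x c m) = ⟦ x , tree-rep c m ⟧

  -- One generator for `◇` containing one for `◁` suffices: `k` applies the cell maps fibrewise,
  -- landing in the sum of the family reindexed along the base, and identifies that sum with the
  -- pullback.
  tree-tens-step : ∀ {X Y C} {u v : Tree X Y C} → TreeStep u v →
                   TensStep (tree-tens u) (tree-tens v)
  tree-tens-step {X} {Y} {C} {u} {v} s = record
    { j = base s ; elt-eq = root-eq s ; sub-eq = EqC.return sub-step }
    where
    n  = size ∘ cells u
    n′ = size ∘ cells v
    f  = fun (base s)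
    module Q = Pullback f (index n′)

    k-fun : Σ (Fin _) (Fin ∘ n) → Fin Q.apex
    k-fun (a , i) = pull-fun n′ f (a , fun (map (cells-eq s a)) i)

    opaque
      k-mem : InCtx (k-fun ∘ decode n)
      k-mem = inCtx (CtxMap-∘ (pull-closed n′ f)
        (CtxMap-Σ id-closed (λ a → mem (map (cells-eq s a)))))

    k : Hom (total n) Q.apex
    k = k-fun ∘ decode n , k-mem

    over : Q.π₁ ∘ fun k ≗ index n
    over p = π₁-pull n′ f _

    square : ∀ a → restrict k over a ∘ᶜ hom-fibre n a
                   ≈ᶜ reindex f (index n′) a ∘ᶜ (hom-fibre n′ (f a) ∘ᶜ map (cells-eq s a))
    square a i = reindexed-injective f (index n′) a
      (trans (cong Q.π₂ (trans (incl-restrict k over a _)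
        (trans (cong (fun k) (incl-fibre n a i)) (cong k-fun (decode-encode n (a , i))))))
      (trans (π₂-pull n′ f _)
      (trans (sym (incl-fibre n′ (f a) _))
             (sym (π₂-reindex f (index n′) a _)))))

    sub-step : Step (tree-rep (cells u) (closed u)) (tree-rep (cells v) (closed v) · base s)
    sub-step = record
      { j        = k
      ; over     = over
      ; head-eq  = λ p → let (a , i) = decode n p in trans (leaf-eq (cells-eq s a) i)
          (cong (leaves (cells v)) (sym (trans (cong (decode n′) (π₂-pull n′ f _)) (decode-encode n′ _))))
      ; terms-eq = λ a → Eqv.trans Y
          (Eqv.trans Y
            (act-comp Y {f = hom-fibre n a} {g = restrict k over a}
              {h = reindex f (index n′) a ∘ᶜ (hom-fibre n′ (f a) ∘ᶜ map (cells-eq s a))} (square a))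
            (Eqv.trans Y (act-∘ Y) (act-cong Y {g = reindex f (index n′) a} (λ _ → refl) (act-∘ Y))))
          (act-cong Y (λ _ → refl) (act-cong Y (λ _ → refl) (label-eq (cells-eq s a))))
      }

  θ⇐ : ∀ X Y → (X ◈ Y) ⇛ (X ◇ Y)
  θ⇐ X Y = record
    { η       = tree-tens
    ; η-cong  = EqC.gmap tree-tens tree-tens-step
    ; natural = λ f u → EqC.return (same-mid (Eqv.refl X)
        (EqC.return (same-proj (λ _ → refl) (λ _ → Eqv.refl Y))))
    }

  θ⇒∘θ⇐ : ∀ {X Y C} (u : Tree X Y C) → tens-tree (tree-tens u) ≋ u
  θ⇒∘θ⇐ {X} {Y} (tree x c m) = EqC.symmetric TreeStep (EqC.return (same-base (Eqv.refl X) λ a → record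
    { map      = hom-fibre (size ∘ c) a
    ; leaf-eq  = λ i → cong (leaves c) (sym (trans
        (cong (decode (size ∘ c)) (incl-fibre (size ∘ c) a i)) (decode-encode (size ∘ c) (a , i))))
    ; label-eq = Eqv.refl Y
    }))

  θ⇐∘θ⇒ : ∀ {X Y C} (u : Tens X Y C) → EqClosure TensStep (tree-tens (tens-tree u)) u
  θ⇐∘θ⇒ {X} {Y} ⟦ x , γ ⟧ = EqC.return (same-mid (Eqv.refl X) (EqC.return (record
    { j        = j
    ; over     = over
    ; head-eq  = λ _ → refl
    ; terms-eq = λ a → Eqv.trans Y
        (act-comp Y {f = hom-fibre n a} {g = restrict j over a} {h = idᶜ} λ i →
          Fibre.incl-injective (proj γ) a (trans (incl-restrict j over a _)
            (cong incl (trans (cong (decode n) (incl-fibre n a i)) (decode-encode n (a , i))))))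
        (act-id Y)
    })))
    where
    n : Fin _ → ℕ
    n a = proj γ ⁻¹ a

    incl : Σ (Fin _) (Fin ∘ n) → Fin (dom γ)
    incl (a , i) = Fibre.incl (proj γ) a i

    j : Hom (total n) (dom γ)
    j = incl ∘ decode n , inCtx (incl-closed (proj γ))

    over : proj γ ∘ fun j ≗ index n
    over p = Fibre.incl-holds (proj γ) _ _

  ◇-monoidal : MonoidalStructure [Ctx,Set] _◇_ _◇₁_ V
  ◇-monoidal = Transport.monoidal [Ctx,Set] ◈-monoidal (θ⇒ _ _) (θ⇐ _ _)
    (record { invˡ = λ C → θ⇒∘θ⇐ ; invʳ = λ C → θ⇐∘θ⇒ })
    (λ C u → EqC.return (treestep-refl _))

-- Right closedness

module Closed (𝒞 : ContextualSubcategory) where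
  open Substitution 𝒞
  open Presheaf
  open Nat

  private
    PS = Presheaf Ctx
    _⇛_ = Nat Ctx

  curry : ∀ {X Y Z} → (X ◇ Y) ⇛ Z → X ⇛ ⟨ Y , Z ⟩◇
  curry {X} {Y} φ = record
    { η       = λ x → record
      { η       = λ γ → η φ ⟦ x , γ ⟧
      ; η-cong  = λ p → η-cong φ (EqC.return (same-mid (Eqv.refl X) p))
      ; natural = λ f γ → natural φ f ⟦ x , γ ⟧
      }
    ; η-cong  = λ p C γ → η-cong φ (EqC.return (same-mid p (Eqv.refl (_ ◁ Y))))
    ; natural = λ f x C γ → η-cong φ (EqC.symmetric TensStep (EqC.return (record
        { j = f ; elt-eq = Eqv.refl X ; sub-eq = Eqv.refl (_ ◁ Y) })))
    }

  -- A generator of `◇` moves a map `j` across the tensor, and `j` acts on `⟨ Y , Z ⟩◇` by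
  -- precomposition with `_· j`; naturality of `θ` at `j` is thus what makes `apply` respect the
  -- quotient.
  uncurry : ∀ {X Y Z} → X ⇛ ⟨ Y , Z ⟩◇ → (X ◇ Y) ⇛ Z
  uncurry {X} {Y} {Z} θ = record
    { η       = apply
    ; η-cong  = EqC.gfold (Setoid.isEquivalence (ob Z _)) apply λ {u} {v} s →
        let module S = TensStep s in
        Eqv.trans Z (η-cong (η θ (elt u)) S.sub-eq)
          (Eqv.trans Z (Eqv.sym Z (natural θ S.j (elt u) _ (sub v)))
            (η-cong θ S.elt-eq _ (sub v)))
    ; natural = λ f u → natural (η θ (elt u)) f (sub u)
    }
    where
    apply : ∀ {C} → Tens X Y C → El Z C
    apply ⟦ x , γ ⟧ = η (η θ x) γ

  ◇-closed : RightClosedStructure [Ctx,Set] _◇_ _◇₁_ ⟨_,_⟩◇ ⟨_,_⟩◇₁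
  ◇-closed = record
    { hom-resp-≈ = λ { {B} {B′} {D} {D′} {f} {f′} {g} {g′} p q A θ C γ → Eqv.trans D′ (q C _)
        (η-cong g′ (η-cong θ (EqC.return (same-proj (λ _ → refl) (λ a → p _ _))))) }
    ; hom-id     = λ {B} {D} A θ C γ → Eqv.refl D
    ; hom-∘      = λ {_} {_} {_} {_} {_} {D″} A θ C γ → Eqv.refl D″
    ; adjunction = λ X Y Z → record
        { to        = curry
        ; from      = uncurry
        ; to-cong   = λ p A x C γ → p C ⟦ x , γ ⟧
        ; from-cong = λ p C u → p (mid u) (elt u) C (sub u)
        ; inverse   = (λ p A x C γ → p C ⟦ x , γ ⟧) , (λ p C u → p (mid u) (elt u) C (sub u))
        }
    ; adjunction-natural = λ {_} {_} {_} {_} {_} {D′} f g h k A x C γ → Eqv.refl D′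
    }

theorem5p13 : (𝒞 : ContextualSubcategory) →
    let open Substitution 𝒞 in
    MonoidalStructure [Ctx,Set] _◇_ _◇₁_ V
    × RightClosedStructure [Ctx,Set] _◇_ _◇₁_ ⟨_,_⟩◇ ⟨_,_⟩◇₁
theorem5p13 𝒞 = Comparison.◇-monoidal 𝒞 , Closed.◇-closed 𝒞
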